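{- Let $\mathcal S$ be a sound, finitely axiomatized, sequential theory extending $S^1_2$ with polynomial-time decidable axioms, such that $\mathcal S$ has polynomial-size proofs of $(\mathrm{Con}_{\mathcal S}(n))_n$, and assume SETH-K-Finite for $\mathcal S$ (stated in the context). Let $\tau_{x,n}$ denote the propositional translation of $\mathrm{Con}_{\mathcal S+(x\in R)}(n)$. Assume that for some constant $a$ the chosen feasible correspondence between the bounded-consistency formalization and its propositional translation carries every propositional proof (in the propositional proof system associated with $\mathcal S$) of $\tau_{x,n}$ of size $s$, where $|x|=m$, to an $\mathcal S$-proof of $\mathrm{Con}_{\mathcal S+(x\in R)}(n)$ of size at most $s\cdot(m+n)^a$. Then for every $m>k_R^{\mathcal S}$ and every $\epsilon$ with $0<\epsilon<1$, there exists $\widetilde N_{R,m,\epsilon}^{\mathcal S}$ such that, for every $n>\widetilde N_{R,m,\epsilon}^{\mathcal S}$, at least $(1-O(m^{ -d}))2^m$ strings $x\in\{0,1\}^m$ index tautologies $\tau_{x,n}$ of size $(m+n)^{O(1)}$ that require size greater than $2^{(1-\epsilon)n}$ in the propositional proof system associated with $\mathcal S$.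
   Context: $S^1_2$ is Buss's bounded arithmetic theory and $\mathrm{EA}$ is elementary arithmetic. $\mathrm{Con}_{\mathcal T}$ is the consistency statement of $\mathcal T$; $\mathrm{Con}_{\mathcal T}(n)$ asserts that $\mathcal T$ has no proof of contradiction of length at most $n$ symbols. $\mathcal S\vdash_{\le L}\theta$ means that $\theta$ has an $\mathcal S$-proof of length at most $L$. A family $\theta(n)$ has polynomial-size $\mathcal S$-proofs if for some constant $c$ and all sufficiently large $n$, $\theta(n)$ has an $\mathcal S$-proof of size at most $n^c$. Fix a deterministic universal Turing machine $U$ and a constant $d\ge 3$; $R=\{x:K_U(x)\ge |x|-d\log|x|\}$, with $K_U$ Kolmogorov complexity without time bound. In $\mathcal S+(x\in R)$ the added axiom is the arithmetized sentence $x\in R$ for the fixed string $x$. Fix a standard polynomial-time propositional translation of bounded-consistency statements; $\tau_{x,n}$ is the translation of $\mathrm{Con}_{\mathcal S+(x\in R)}(n)$, of size $(m+n)^{O(1)}$ where $m=|x|$; it is a tautology when $x\in R$ is true. Let $C_{\mathrm{rel}}^{\mathcal S}=\{x\in R:\mathrm{EA}\vdash \mathrm{Con}_{\mathcal S}\rightarrow\mathrm{Con}_{\mathcal S+(x\in R)}\}$. This set is finite, and $k_R^{\mathcal S}$ is a fixed integer exceeding the maximum length of its elements. SETH-K-Finite for $\mathcal S$: for every $m>k_R^{\mathcal S}$ and every $\epsilon$ with $0<\epsilon<1$, there exists $N_{R,m,\epsilon}^{\mathcal S}$ such that, for every true $x\in R\cap\{0,1\}^m$ and every $n>N_{R,m,\epsilon}^{\mathcal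 S}$, one has $\mathcal S\vdash_{\le 2^{(1-\epsilon)n}}\mathrm{Con}_{\mathcal S+(x\in R)}(n)$ if and only if $\mathrm{EA}\vdash\mathrm{Con}_{\mathcal S}\rightarrow\mathrm{Con}_{\mathcal S+(x\in R)}$. -}

module Defs where

open import Data.Bool using (Bool; true; false)
open import Data.Empty using (⊥)
open import Data.Fin as Fin using (Fin; zero; suc; toℕ)
open import Data.Integer using (+_)
open import Data.List using (List; []; _∷_; _++_; length; map; concatMap; foldl; replicate; reverse)
open import Data.List as List using ()
open import Data.List.Membership.Propositional using (_∈_)
open import Data.List.Relation.Unary.All using (All)
open import Data.List.Relation.Unary.Unique.Propositional using (Unique)
open import Data.Maybe using (Maybe; just; nothing)
open import Data.Nat using (ℕ; zero; suc; _+_; _*_; _^_; _≤_; _<_; ⌊_/2⌋)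
open import Data.Nat.Binary using (ℕᵇ; 2[1+_]; 1+[2_]; fromℕ)
open import Data.Nat.Binary as ℕᵇ using ()
open import Data.Nat.Logarithm using (⌈log₂_⌉)
open import Data.Product using (Σ; ∃; ∃-syntax; _×_; _,_; proj₁; proj₂)
open import Data.Rational.Unnormalised as ℚᵘ using (ℚᵘ; mkℚᵘ; 0ℚᵘ; 1ℚᵘ)
open import Data.Sum using (_⊎_)
open import Data.Vec using (Vec; []; _∷_)
open import Data.Vec as Vec using ()
open import Function using (_∘_)
open import Function.Bundles using (_⇔_)
open import Relation.Binary.PropositionalEquality using (_≡_)
open import Relation.Nullary using (¬_)

-- Two-sided Dedekind cuts.  Roundedness makes both predicates respect
-- the equality _≃_ of unnormalised rationals.
record ℝ : Set₁ where
  field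
    Lower Upper   : ℚᵘ → Set
    lower-inhab   : ∃[ p ] Lower p
    upper-inhab   : ∃[ p ] Upper p
    lower-rounded : ∀ p → Lower p ⇔ (∃[ q ] (p ℚᵘ.< q × Lower q))
    upper-rounded : ∀ p → Upper p ⇔ (∃[ q ] (q ℚᵘ.< p × Upper q))
    disjoint      : ∀ p → ¬ (Lower p × Upper p)
    located       : ∀ p q → p ℚᵘ.< q → Lower p ⊎ Upper q

0<_ : ℝ → Set
0< ε = ℝ.Lower ε 0ℚᵘ

_<1 : ℝ → Set
ε <1 = ℝ.Upper ε 1ℚᵘ

-- mkℚᵘ (+ a) b is the rational a/(b+1).
_/1+_<ℝ_ : ℕ → ℕ → ℝ → Set
a /1+ b <ℝ ε = ℝ.Lower ε (mkℚᵘ (+ a) b)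

-- For ε > 0, the number 2^((1-ε)n) is the infimum of 2^((1-q)n) over the
-- rationals 0 ≤ q < ε, and for q = a/b the inequality ℓ ≤ 2^((1-q)n)
-- is ℓ^b · 2^(an) ≤ 2^(bn).
_≤2^[1-_]·_ : ℕ → ℝ → ℕ → Set
ℓ ≤2^[1- ε ]· n =
  ∀ a b → a /1+ b <ℝ ε → ℓ ^ suc b * 2 ^ (a * n) ≤ 2 ^ (suc b * n)

_>2^[1-_]·_ : ℕ → ℝ → ℕ → Set
ℓ >2^[1- ε ]· n =
  ∃[ a ] ∃[ b ] (a /1+ b <ℝ ε × 2 ^ (suc b * n) < ℓ ^ suc b * 2 ^ (a * n))

Str : Set
Str = List Bool

bitℕ : Bool → ℕ
bitℕ false = 0
bitℕ true  = 1

-- The number with binary expansion 1w; its bit length is length w + 1.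
code : Str → ℕ
code = foldl (λ c b → 2 * c + bitℕ b) 1

-- Self-delimiting pairing: the bits of u doubled, then 01, then v.
pair : Str → Str → Str
pair u v = concatMap (λ b → b ∷ b ∷ []) u ++ (false ∷ true ∷ v)

unary : ℕ → Str
unary n = replicate n true

data Move : Set where
  left right : Move

-- The tape left of the head is listed from the head outwards.
record Config (State Sym : Set) : Set where
  constructor config
  field
    state     : State
    leftTape  : List Sym
    head      : Sym
    rightTape : List Sym

-- Deterministic, one two-way infinite tape.  Tape symbols 0, 1, 2 are
-- the blank and the two input bits; state 0 is initial; the machine halts
-- where δ is undefined.
record TM : Set where
  field
    states : ℕ
    extra  : ℕ
    δ      : Fin (suc states) → Fin (3 + extra) →
             Maybe (Fin (suc states) × Fin (3 + extra) × Move)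

  State Sym Cfg : Set
  State = Fin (suc states)
  Sym   = Fin (3 + extra)
  Cfg   = Config State Sym

  blank : Sym
  blank = zero

  bitSym : Bool → Sym
  bitSym false = suc zero
  bitSym true  = suc (suc zero)

  moveTo : State → List Sym → Sym → List Sym → Move → Cfg
  moveTo q []       s r        left  = config q [] blank (s ∷ r)
  moveTo q (h ∷ l)  s r        left  = config q l h (s ∷ r)
  moveTo q l        s []       right = config q (s ∷ l) blank []
  moveTo q l        s (h ∷ r)  right = config q (s ∷ l) h r

  step : Cfg → Maybe Cfg
  step (config q l h r) with δ q h
  ... | nothing            = nothing
  ... | just (q′ , s , mv) = just (moveTo q′ l s r mv)

  initial : Str → Cfg
  initial []      = config zero [] blank []
  initial (b ∷ w) = config zero [] (bitSym b) (map bitSym w)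

  readBits : List Sym → Str
  readBits (suc zero       ∷ r) = false ∷ readBits r
  readBits (suc (suc zero) ∷ r) = true ∷ readBits r
  readBits _                    = []

  -- The maximal block of bits starting at the head.
  output : Cfg → Str
  output (config _ _ h r) = readBits (h ∷ r)

  HaltsFrom : Cfg → ℕ → Str → Set
  HaltsFrom c zero    y = step c ≡ nothing × output c ≡ y
  HaltsFrom c (suc t) y = ∃[ c′ ] (step c ≡ just c′ × HaltsFrom c′ t y)

_on_⇓[_]_ : TM → Str → ℕ → Str → Set
M on w ⇓[ t ] y = TM.HaltsFrom M (TM.initial M w) t y

_on_⇓_ : TM → Str → Str → Set
M on w ⇓ y = ∃[ t ] M on w ⇓[ t ] y

-- Every machine is simulated with a constant overhead in program length.
Universal : TM → Set
Universal U =
  ∀ (M : TM) → ∃[ c ] ∀ (p : Str) → ∃[ q ] (length q ≤ length p + c × (∀ y → M on p ⇓ y ⇔ U on q ⇓ y))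

PolyTimeComputable : {A : Set} (input output : A → Str) → Set
PolyTimeComputable {A} input output =
  ∃[ M ] ∃[ c ] ((a : A) →
    ∃[ t ] (t ≤ length (input a) ^ c + c × M on input a ⇓[ t ] output a))

PolyTimeDecidable : (Str → Set) → Set
PolyTimeDecidable P =
  Σ (Str → Bool) λ χ →
    PolyTimeComputable {Str} (λ w → w) (λ w → χ w ∷ []) × (∀ w → χ w ≡ true ⇔ P w)

-- k = K_U(x)
IsK : TM → Str → ℕ → Set
IsK U x k =
  (∃[ p ] (U on p ⇓ x × length p ≡ k)) × (∀ p → U on p ⇓ x → k ≤ length p)

-- K_U(x) ≥ |x| - d log₂|x|, exponentiated: 2^|x| ≤ 2^(K_U(x)) · |x|^d.
InR : TM → ℕ → Str → Set
InR U d x = ∀ k → IsK U x k → 2 ^ length x ≤ 2 ^ k * length x ^ d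

-- Finite languages extending Buss's language 0, S, +, ·, #, |x|, ⌊x/2⌋, ≤,
-- given by the arities of the additional symbols.
record Language : Set where
  field
    extraFn  : List ℕ
    extraRel : List ℕ

open Language

Lᵇ : Language
Lᵇ = record { extraFn = [] ; extraRel = [] }

data Fn (L : Language) : ℕ → Set where
  zeroᶠ                : Fn L 0
  sucᶠ halfᶠ lenᶠ      : Fn L 1
  addᶠ mulᶠ smashᶠ     : Fn L 2
  extraᶠ : (i : Fin (length (extraFn L))) → Fn L (List.lookup (extraFn L) i)

data Rel (L : Language) : ℕ → Set where
  leqʳ   : Rel L 2
  extraʳ : (i : Fin (length (extraRel L))) → Rel L (List.lookup (extraRel L) i)

data Term (L : Language) (n : ℕ) : Set where
  var : Fin n → Term L n
  app : ∀ {k} → Fn L k → Vec (Term L n) k → Term L n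

infix  8 _≐_
infixr 7 ¬̇_ ∀̇_ ∃̇_
infixr 6 _∧̇_
infixr 5 _∨̇_
infixr 4 _⇒̇_
infix  4 _⇔̇_

-- De Bruijn: quantifiers bind variable 0.
data Formula (L : Language) : ℕ → Set where
  _≐_  : ∀ {n} → Term L n → Term L n → Formula L n
  rel  : ∀ {n k} → Rel L k → Vec (Term L n) k → Formula L n
  ¬̇_   : ∀ {n} → Formula L n → Formula L n
  _∧̇_ _∨̇_ _⇒̇_ : ∀ {n} → Formula L n → Formula L n → Formula L n
  ∀̇_ ∃̇_ : ∀ {n} → Formula L (suc n) → Formula L n

Sentence : Language → Set
Sentence L = Formula L 0

_⇔̇_ : ∀ {L n} → Formula L n → Formula L n → Formula L n
φ ⇔̇ ψ = (φ ⇒̇ ψ) ∧̇ (ψ ⇒̇ φ)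

∀closure : ∀ {L} n → Formula L n → Sentence L
∀closure zero    φ = φ
∀closure (suc n) φ = ∀closure n (∀̇ φ)

mutual
  substT : ∀ {L m n} → (Fin m → Term L n) → Term L m → Term L n
  substT σ (var i)    = σ i
  substT σ (app f ts) = app f (substTs σ ts)

  substTs : ∀ {L m n k} → (Fin m → Term L n) → Vec (Term L m) k → Vec (Term L n) k
  substTs σ []       = []
  substTs σ (t ∷ ts) = substT σ t ∷ substTs σ ts

renameT : ∀ {L m n} → (Fin m → Fin n) → Term L m → Term L n
renameT ρ = substT (var ∘ ρ)

lift↑ : ∀ {L m n} → (Fin m → Term L n) → Fin (suc m) → Term L (suc n)
lift↑ σ zero    = var zero
lift↑ σ (suc i) = renameT suc (σ i)

subst : ∀ {L m n} → (Fin m → Term L n) → Formula L m → Formula L n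
subst σ (s ≐ t)    = substT σ s ≐ substT σ t
subst σ (rel r ts) = rel r (substTs σ ts)
subst σ (¬̇ φ)      = ¬̇ subst σ φ
subst σ (φ ∧̇ ψ)    = subst σ φ ∧̇ subst σ ψ
subst σ (φ ∨̇ ψ)    = subst σ φ ∨̇ subst σ ψ
subst σ (φ ⇒̇ ψ)    = subst σ φ ⇒̇ subst σ ψ
subst σ (∀̇ φ)      = ∀̇ subst (lift↑ σ) φ
subst σ (∃̇ φ)      = ∃̇ subst (lift↑ σ) φ

rename : ∀ {L m n} → (Fin m → Fin n) → Formula L m → Formula L n
rename ρ = subst (var ∘ ρ)

weaken : ∀ {L n} → Formula L n → Formula L (suc n)
weaken = rename suc

weakenT : ∀ {L n} → Term L n → Term L (suc n)
weakenT = renameT suc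

-- Replace variable 0 by t, keeping the others.
inst : ∀ {L n} → Term L n → Fin (suc n) → Term L n
inst t zero    = t
inst t (suc i) = var i

_[_] : ∀ {L n} → Formula L (suc n) → Term L n → Formula L n
φ [ t ] = subst (inst t) φ

-- Simultaneous substitution; the i-th term replaces variable i.
_⟨_⟩ : ∀ {L m n} → Formula L m → Vec (Term L n) m → Formula L n
φ ⟨ ts ⟩ = subst (Vec.lookup ts) φ

liftFn : ∀ {L k} → Fn Lᵇ k → Fn L k
liftFn zeroᶠ  = zeroᶠ
liftFn sucᶠ   = sucᶠ
liftFn halfᶠ  = halfᶠ
liftFn lenᶠ   = lenᶠ
liftFn addᶠ   = addᶠ
liftFn mulᶠ   = mulᶠ
liftFn smashᶠ = smashᶠ
liftFn (extraᶠ ())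

liftRel : ∀ {L k} → Rel Lᵇ k → Rel L k
liftRel leqʳ = leqʳ
liftRel (extraʳ ())

mutual
  liftT : ∀ {L n} → Term Lᵇ n → Term L n
  liftT (var i)    = var i
  liftT (app f ts) = app (liftFn f) (liftTs ts)

  liftTs : ∀ {L n k} → Vec (Term Lᵇ n) k → Vec (Term L n) k
  liftTs []       = []
  liftTs (t ∷ ts) = liftT t ∷ liftTs ts

lift : ∀ {L n} → Formula Lᵇ n → Formula L n
lift (s ≐ t)    = liftT s ≐ liftT t
lift (rel r ts) = rel (liftRel r) (liftTs ts)
lift (¬̇ φ)      = ¬̇ lift φ
lift (φ ∧̇ ψ)    = lift φ ∧̇ lift ψ
lift (φ ∨̇ ψ)    = lift φ ∨̇ lift ψ
lift (φ ⇒̇ ψ)    = lift φ ⇒̇ lift ψ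
lift (∀̇ φ)      = ∀̇ lift φ
lift (∃̇ φ)      = ∃̇ lift φ

infixl 10 _∙_ _♯_
infixl 9  _⊕_
infix  8  _≼_

Z : ∀ {L n} → Term L n
Z = app zeroᶠ []

𝐒 ½ ∣_∣ : ∀ {L n} → Term L n → Term L n
𝐒 t   = app sucᶠ (t ∷ [])
½ t   = app halfᶠ (t ∷ [])
∣ t ∣ = app lenᶠ (t ∷ [])

_⊕_ _∙_ _♯_ : ∀ {L n} → Term L n → Term L n → Term L n
s ⊕ t = app addᶠ (s ∷ t ∷ [])
s ∙ t = app mulᶠ (s ∷ t ∷ [])
s ♯ t = app smashᶠ (s ∷ t ∷ [])

_≼_ : ∀ {L n} → Term L n → Term L n → Formula L n
s ≼ t = rel leqʳ (s ∷ t ∷ [])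

𝟏 𝟐 : ∀ {L n} → Term L n
𝟏 = 𝐒 Z
𝟐 = 𝐒 𝟏

_^̇_ : ∀ {L n} → Term L n → ℕ → Term L n
t ^̇ zero  = 𝟏
t ^̇ suc d = t ∙ (t ^̇ d)

-- Numerals of length O(log n).
numeralᵇ : ∀ {L n} → ℕᵇ → Term L n
numeralᵇ ℕᵇ.zero  = Z
numeralᵇ 2[1+ x ] = 𝟐 ∙ 𝐒 (numeralᵇ x)
numeralᵇ 1+[2 x ] = 𝐒 (𝟐 ∙ numeralᵇ x)

num : ∀ {L n} → ℕ → Term L n
num k = numeralᵇ (fromℕ k)

-- Buss's |x| = ⌈log₂ (x+1)⌉.
bitLength : ℕ → ℕ
bitLength x = ⌈log₂ suc x ⌉

evalFn : ∀ {k} → Fn Lᵇ k → Vec ℕ k → ℕ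
evalFn zeroᶠ  []           = 0
evalFn sucᶠ   (x ∷ [])     = suc x
evalFn halfᶠ  (x ∷ [])     = ⌊ x /2⌋
evalFn lenᶠ   (x ∷ [])     = bitLength x
evalFn addᶠ   (x ∷ y ∷ []) = x + y
evalFn mulᶠ   (x ∷ y ∷ []) = x * y
evalFn smashᶠ (x ∷ y ∷ []) = 2 ^ (bitLength x * bitLength y)
evalFn (extraᶠ ())

mutual
  evalT : ∀ {n} → Vec ℕ n → Term Lᵇ n → ℕ
  evalT e (var i)    = Vec.lookup e i
  evalT e (app f ts) = evalFn f (evalTs e ts)

  evalTs : ∀ {n k} → Vec ℕ n → Vec (Term Lᵇ n) k → Vec ℕ k
  evalTs e []       = []
  evalTs e (t ∷ ts) = evalT e t ∷ evalTs e ts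

evalRel : ∀ {k} → Rel Lᵇ k → Vec ℕ k → Set
evalRel leqʳ (x ∷ y ∷ []) = x ≤ y
evalRel (extraʳ ())

infix 3 _⊨_

-- Satisfaction in ℕ; entry i of the vector is the value of variable i.
_⊨_ : ∀ {n} → Vec ℕ n → Formula Lᵇ n → Set
e ⊨ s ≐ t    = evalT e s ≡ evalT e t
e ⊨ rel r ts = evalRel r (evalTs e ts)
e ⊨ ¬̇ φ      = ¬ (e ⊨ φ)
e ⊨ φ ∧̇ ψ    = (e ⊨ φ) × (e ⊨ ψ)
e ⊨ φ ∨̇ ψ    = (e ⊨ φ) ⊎ (e ⊨ ψ)
e ⊨ φ ⇒̇ ψ    = (e ⊨ φ) → (e ⊨ ψ)
e ⊨ ∀̇ φ      = ∀ x → x ∷ e ⊨ φ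
e ⊨ ∃̇ φ      = ∃[ x ] (x ∷ e ⊨ φ)

ℕ⊨_ : Sentence Lᵇ → Set
ℕ⊨ φ = [] ⊨ φ

∀̇≤ ∃̇≤ : ∀ {L n} → Term L n → Formula L (suc n) → Formula L n
∀̇≤ t φ = ∀̇ (var zero ≼ weakenT t ⇒̇ φ)
∃̇≤ t φ = ∃̇ (var zero ≼ weakenT t ∧̇ φ)

data Bounded {L : Language} : ∀ {n} → Formula L n → Set where
  eqᴮ  : ∀ {n} {s t : Term L n} → Bounded (s ≐ t)
  relᴮ : ∀ {n k} {r : Rel L k} {ts : Vec (Term L n) k} → Bounded (rel r ts)
  negᴮ : ∀ {n} {φ : Formula L n} → Bounded φ → Bounded (¬̇ φ)
  andᴮ : ∀ {n} {φ ψ : Formula L n} → Bounded φ → Bounded ψ → Bounded (φ ∧̇ ψ)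
  orᴮ  : ∀ {n} {φ ψ : Formula L n} → Bounded φ → Bounded ψ → Bounded (φ ∨̇ ψ)
  impᴮ : ∀ {n} {φ ψ : Formula L n} → Bounded φ → Bounded ψ → Bounded (φ ⇒̇ ψ)
  allᴮ : ∀ {n} {t : Term L n} {φ} → Bounded φ → Bounded (∀̇≤ t φ)
  exᴮ  : ∀ {n} {t : Term L n} {φ} → Bounded φ → Bounded (∃̇≤ t φ)

data SharplyBounded : ∀ {n} → Formula Lᵇ n → Set where
  eqˢ  : ∀ {n} {s t : Term Lᵇ n} → SharplyBounded (s ≐ t)
  relˢ : ∀ {n k} {r : Rel Lᵇ k} {ts : Vec (Term Lᵇ n) k} → SharplyBounded (rel r ts)
  negˢ : ∀ {n} {φ : Formula Lᵇ n} → SharplyBounded φ → SharplyBounded (¬̇ φ)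
  andˢ : ∀ {n} {φ ψ : Formula Lᵇ n} → SharplyBounded φ → SharplyBounded ψ → SharplyBounded (φ ∧̇ ψ)
  orˢ  : ∀ {n} {φ ψ : Formula Lᵇ n} → SharplyBounded φ → SharplyBounded ψ → SharplyBounded (φ ∨̇ ψ)
  impˢ : ∀ {n} {φ ψ : Formula Lᵇ n} → SharplyBounded φ → SharplyBounded ψ → SharplyBounded (φ ⇒̇ ψ)
  allˢ : ∀ {n} {t : Term Lᵇ n} {φ} → SharplyBounded φ → SharplyBounded (∀̇≤ ∣ t ∣ φ)
  exˢ  : ∀ {n} {t : Term Lᵇ n} {φ} → SharplyBounded φ → SharplyBounded (∃̇≤ ∣ t ∣ φ)

mutual
  data Σᵇ₁ : ∀ {n} → Formula Lᵇ n → Set where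
    sharp : ∀ {n} {φ : Formula Lᵇ n} → SharplyBounded φ → Σᵇ₁ φ
    neg   : ∀ {n} {φ : Formula Lᵇ n} → Πᵇ₁ φ → Σᵇ₁ (¬̇ φ)
    and   : ∀ {n} {φ ψ : Formula Lᵇ n} → Σᵇ₁ φ → Σᵇ₁ ψ → Σᵇ₁ (φ ∧̇ ψ)
    or    : ∀ {n} {φ ψ : Formula Lᵇ n} → Σᵇ₁ φ → Σᵇ₁ ψ → Σᵇ₁ (φ ∨̇ ψ)
    imp   : ∀ {n} {φ ψ : Formula Lᵇ n} → Πᵇ₁ φ → Σᵇ₁ ψ → Σᵇ₁ (φ ⇒̇ ψ)
    all   : ∀ {n} {t : Term Lᵇ n} {φ} → Σᵇ₁ φ → Σᵇ₁ (∀̇≤ ∣ t ∣ φ)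
    ex    : ∀ {n} {t : Term Lᵇ n} {φ} → Σᵇ₁ φ → Σᵇ₁ (∃̇≤ t φ)

  data Πᵇ₁ : ∀ {n} → Formula Lᵇ n → Set where
    sharp : ∀ {n} {φ : Formula Lᵇ n} → SharplyBounded φ → Πᵇ₁ φ
    neg   : ∀ {n} {φ : Formula Lᵇ n} → Σᵇ₁ φ → Πᵇ₁ (¬̇ φ)
    and   : ∀ {n} {φ ψ : Formula Lᵇ n} → Πᵇ₁ φ → Πᵇ₁ ψ → Πᵇ₁ (φ ∧̇ ψ)
    or    : ∀ {n} {φ ψ : Formula Lᵇ n} → Πᵇ₁ φ → Πᵇ₁ ψ → Πᵇ₁ (φ ∨̇ ψ)
    imp   : ∀ {n} {φ ψ : Formula Lᵇ n} → Σᵇ₁ φ → Πᵇ₁ ψ → Πᵇ₁ (φ ⇒̇ ψ)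
    all   : ∀ {n} {t : Term Lᵇ n} {φ} → Πᵇ₁ φ → Πᵇ₁ (∀̇≤ t φ)
    ex    : ∀ {n} {t : Term Lᵇ n} {φ} → Πᵇ₁ φ → Πᵇ₁ (∃̇≤ ∣ t ∣ φ)

Theory : Language → Set₁
Theory L = Sentence L → Set

-- A line is a formula together with the number of its free variables.
Line : Language → Set
Line L = Σ ℕ (Formula L)

-- Kleene's Hilbert-style axioms of classical logic, with equality.
data LogicalAxiom {L : Language} {n : ℕ} : Formula L n → Set where
  const : ∀ A B → LogicalAxiom (A ⇒̇ B ⇒̇ A)
  distr : ∀ A B C → LogicalAxiom ((A ⇒̇ B) ⇒̇ (A ⇒̇ B ⇒̇ C) ⇒̇ A ⇒̇ C)
  pairI : ∀ A B → LogicalAxiom (A ⇒̇ B ⇒̇ A ∧̇ B)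
  fst   : ∀ A B → LogicalAxiom (A ∧̇ B ⇒̇ A)
  snd   : ∀ A B → LogicalAxiom (A ∧̇ B ⇒̇ B)
  inl   : ∀ A B → LogicalAxiom (A ⇒̇ A ∨̇ B)
  inr   : ∀ A B → LogicalAxiom (B ⇒̇ A ∨̇ B)
  cases : ∀ A B C → LogicalAxiom ((A ⇒̇ C) ⇒̇ (B ⇒̇ C) ⇒̇ A ∨̇ B ⇒̇ C)
  negI  : ∀ A B → LogicalAxiom ((A ⇒̇ B) ⇒̇ (A ⇒̇ ¬̇ B) ⇒̇ ¬̇ A)
  dne   : ∀ A → LogicalAxiom (¬̇ ¬̇ A ⇒̇ A)
  allE  : ∀ A t → LogicalAxiom (∀̇ A ⇒̇ A [ t ])
  exI   : ∀ A t → LogicalAxiom (A [ t ] ⇒̇ ∃̇ A)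
  eqI   : ∀ t → LogicalAxiom (t ≐ t)
  eqE   : ∀ A t u → LogicalAxiom (t ≐ u ⇒̇ A [ t ] ⇒̇ A [ u ])

data Justified {L : Language} (T : Theory L) (Γ : List (Line L)) : Line L → Set where
  axiom     : ∀ {n φ} → T φ → Justified T Γ (n , rename (λ ()) φ)
  logical   : ∀ {n φ} → LogicalAxiom φ → Justified T Γ (n , φ)
  mp        : ∀ {n φ ψ} → (n , φ ⇒̇ ψ) ∈ Γ → (n , φ) ∈ Γ → Justified T Γ (n , ψ)
  allI      : ∀ {n C A} → (suc n , weaken C ⇒̇ A) ∈ Γ → Justified T Γ (n , C ⇒̇ ∀̇ A)
  exE       : ∀ {n A C} → (suc n , A ⇒̇ weaken C) ∈ Γ → Justified T Γ (n , ∃̇ A ⇒̇ C)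
  renameVar : ∀ {m n φ} (ρ : Fin m → Fin n) → (m , φ) ∈ Γ → Justified T Γ (n , rename ρ φ)

-- Lines are listed latest first.
data Derivation {L : Language} (T : Theory L) : List (Line L) → Set where
  []  : Derivation T []
  _▷_ : ∀ {Γ ℓ} → Derivation T Γ → Justified T Γ ℓ → Derivation T (ℓ ∷ Γ)

IsProof : ∀ {L} → Theory L → Sentence L → List (Line L) → Set
IsProof T θ Γ = Derivation T Γ × ∃[ Δ ] (Γ ≡ (0 , θ) ∷ Δ)

data Symbol : Set where
  d1 d2 var fn rel eq neg and or imp all ex newline : Symbol

-- Bijective base 2.
digitsᵇ : ℕᵇ → List Symbol
digitsᵇ ℕᵇ.zero  = []
digitsᵇ 2[1+ x ] = d2 ∷ digitsᵇ x
digitsᵇ 1+[2 x ] = d1 ∷ digitsᵇ x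

digits : ℕ → List Symbol
digits = digitsᵇ ∘ fromℕ

fnIndex : ∀ {L k} → Fn L k → ℕ
fnIndex zeroᶠ      = 0
fnIndex sucᶠ       = 1
fnIndex halfᶠ      = 2
fnIndex lenᶠ       = 3
fnIndex addᶠ       = 4
fnIndex mulᶠ       = 5
fnIndex smashᶠ     = 6
fnIndex (extraᶠ i) = 7 + toℕ i

relIndex : ∀ {L k} → Rel L k → ℕ
relIndex leqʳ       = 0
relIndex (extraʳ i) = 1 + toℕ i

mutual
  writeT : ∀ {L n} → Term L n → List Symbol
  writeT (var i)    = var ∷ digits (toℕ i)
  writeT (app f ts) = fn ∷ digits (fnIndex f) ++ writeTs ts

  writeTs : ∀ {L n k} → Vec (Term L n) k → List Symbol
  writeTs []       = []
  writeTs (t ∷ ts) = writeT t ++ writeTs ts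

-- Prefix notation.
write : ∀ {L n} → Formula L n → List Symbol
write (s ≐ t)    = eq ∷ writeT s ++ writeT t
write (rel r ts) = rel ∷ digits (relIndex r) ++ writeTs ts
write (¬̇ φ)      = neg ∷ write φ
write (φ ∧̇ ψ)    = and ∷ write φ ++ write ψ
write (φ ∨̇ ψ)    = or ∷ write φ ++ write ψ
write (φ ⇒̇ ψ)    = imp ∷ write φ ++ write ψ
write (∀̇ φ)      = all ∷ write φ
write (∃̇ φ)      = ex ∷ write φ

writeProof : ∀ {L} → List (Line L) → List Symbol
writeProof Γ = concatMap (λ (n , φ) → newline ∷ digits n ++ write φ) (reverse Γ)

proofSize : ∀ {L} → List (Line L) → ℕ
proofSize Γ = length (writeProof Γ)

symbolBits : Symbol → Str
symbolBits d1      = false ∷ false ∷ false ∷ false ∷ []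
symbolBits d2      = false ∷ false ∷ false ∷ true  ∷ []
symbolBits var     = false ∷ false ∷ true  ∷ false ∷ []
symbolBits fn      = false ∷ false ∷ true  ∷ true  ∷ []
symbolBits rel     = false ∷ true  ∷ false ∷ false ∷ []
symbolBits eq      = false ∷ true  ∷ false ∷ true  ∷ []
symbolBits neg     = false ∷ true  ∷ true  ∷ false ∷ []
symbolBits and     = false ∷ true  ∷ true  ∷ true  ∷ []
symbolBits or      = true  ∷ false ∷ false ∷ false ∷ []
symbolBits imp     = true  ∷ false ∷ false ∷ true  ∷ []
symbolBits all     = true  ∷ false ∷ true  ∷ false ∷ []
symbolBits ex      = true  ∷ false ∷ true  ∷ true  ∷ []
symbolBits newline = true  ∷ true  ∷ false ∷ false ∷ []

bits : List Symbol → Str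
bits = concatMap symbolBits

gödel : List Symbol → ℕ
gödel = code ∘ bits

⌜_⌝ : ∀ {L n} → Formula L n → ℕ
⌜ φ ⌝ = gödel (write φ)

infix 3 _⊢_ _⊢[≤_]_

_⊢_ : ∀ {L} → Theory L → Sentence L → Set
T ⊢ θ = ∃[ Γ ] IsProof T θ Γ

_⊢[≤_]_ : ∀ {L} → Theory L → ℕ → Sentence L → Set
T ⊢[≤ b ] θ = ∃[ Γ ] (IsProof T θ Γ × proofSize Γ ≤ b)

_⊢[≤2^[1-_]·_]_ : ∀ {L} → Theory L → ℝ → ℕ → Sentence L → Set
T ⊢[≤2^[1- ε ]· n ] θ = ∃[ Γ ] (IsProof T θ Γ × proofSize Γ ≤2^[1- ε ]· n)

_⊕ᵀ_ : ∀ {L} → Theory L → Sentence L → Theory L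
(T ⊕ᵀ θ) φ = T φ ⊎ φ ≡ θ

module _ {L : Language} where
  private
    x y z u v : Term L 5
    x = var zero
    y = var (suc zero)
    z = var (suc (suc zero))
    u = var (suc (suc (suc zero)))
    v = var (suc (suc (suc (suc zero))))

  -- Buss's 32 axioms.
  BASIC : List (Formula L 5)
  BASIC =
      (y ≼ x ⇒̇ y ≼ 𝐒 x)
    ∷ (¬̇ x ≐ 𝐒 x)
    ∷ (Z ≼ x)
    ∷ ((x ≼ y ∧̇ ¬̇ x ≐ y) ⇔̇ 𝐒 x ≼ y)
    ∷ (¬̇ x ≐ Z ⇒̇ ¬̇ 𝟐 ∙ x ≐ Z)
    ∷ (y ≼ x ∨̇ x ≼ y)
    ∷ (x ≼ y ∧̇ y ≼ x ⇒̇ x ≐ y)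
    ∷ (x ≼ y ∧̇ y ≼ z ⇒̇ x ≼ z)
    ∷ (∣ Z ∣ ≐ Z)
    ∷ (¬̇ x ≐ Z ⇒̇ ∣ 𝟐 ∙ x ∣ ≐ 𝐒 ∣ x ∣ ∧̇ ∣ 𝐒 (𝟐 ∙ x) ∣ ≐ 𝐒 ∣ x ∣)
    ∷ (∣ 𝟏 ∣ ≐ 𝟏)
    ∷ (x ≼ y ⇒̇ ∣ x ∣ ≼ ∣ y ∣)
    ∷ (∣ x ♯ y ∣ ≐ 𝐒 (∣ x ∣ ∙ ∣ y ∣))
    ∷ (Z ♯ y ≐ 𝟏)
    ∷ (¬̇ x ≐ Z ⇒̇ 𝟏 ♯ (𝟐 ∙ x) ≐ 𝟐 ∙ (𝟏 ♯ x) ∧̇ 𝟏 ♯ 𝐒 (𝟐 ∙ x) ≐ 𝟐 ∙ (𝟏 ♯ x))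
    ∷ (x ♯ y ≐ y ♯ x)
    ∷ (∣ x ∣ ≐ ∣ y ∣ ⇒̇ x ♯ z ≐ y ♯ z)
    ∷ (∣ x ∣ ≐ ∣ u ∣ ⊕ ∣ v ∣ ⇒̇ x ♯ y ≐ (u ♯ y) ∙ (v ♯ y))
    ∷ (x ≼ x ⊕ y)
    ∷ (x ≼ y ∧̇ ¬̇ x ≐ y ⇒̇ 𝐒 (𝟐 ∙ x) ≼ 𝟐 ∙ y ∧̇ ¬̇ 𝐒 (𝟐 ∙ x) ≐ 𝟐 ∙ y)
    ∷ (x ⊕ y ≐ y ⊕ x)
    ∷ (x ⊕ Z ≐ x)
    ∷ (x ⊕ 𝐒 y ≐ 𝐒 (x ⊕ y))
    ∷ ((x ⊕ y) ⊕ z ≐ x ⊕ (y ⊕ z))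
    ∷ (x ⊕ y ≼ x ⊕ z ⇔̇ y ≼ z)
    ∷ (x ∙ Z ≐ Z)
    ∷ (x ∙ 𝐒 y ≐ (x ∙ y) ⊕ x)
    ∷ (x ∙ y ≐ y ∙ x)
    ∷ (x ∙ (y ⊕ z) ≐ (x ∙ y) ⊕ (x ∙ z))
    ∷ (𝟏 ≼ x ⇒̇ (x ∙ y ≼ x ∙ z ⇔̇ y ≼ z))
    ∷ (¬̇ x ≐ Z ⇒̇ ∣ x ∣ ≐ 𝐒 ∣ ½ x ∣)
    ∷ (x ≐ ½ y ⇔̇ (𝟐 ∙ x ≐ y ∨̇ 𝐒 (𝟐 ∙ x) ≐ y))
    ∷ []

-- φ(t) with variable 0 as the argument of t.
_at_ : ∀ {L n} → Formula L (suc n) → Term L (suc n) → Formula L (suc n)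
φ at t = subst (λ { zero → t ; (suc i) → var (suc i) }) φ

data S¹₂ : Theory Lᵇ where
  basic : ∀ {φ} → φ ∈ BASIC → S¹₂ (∀closure 5 φ)
  pind  : ∀ {n} {φ : Formula Lᵇ (suc n)} → Σᵇ₁ φ →
          S¹₂ (∀closure n (φ [ Z ] ∧̇ ∀̇ (φ at ½ (var zero) ⇒̇ φ) ⇒̇ ∀̇ φ))

Lᵉˣᵖ : Language
Lᵉˣᵖ = record { extraFn = 1 ∷ [] ; extraRel = [] }

exp : ∀ {n} → Term Lᵉˣᵖ n → Term Lᵉˣᵖ n
exp t = app (extraᶠ zero) (t ∷ [])

-- IΔ₀(exp).  Buss's function symbols are kept in the language, so that
-- arithmetized sentences of Lᵇ are literally sentences of EA; their
-- defining axioms make this a definitional extension of the usual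
-- presentation.
data EA : Theory Lᵉˣᵖ where
  basic   : ∀ {φ} → φ ∈ BASIC → EA (∀closure 5 φ)
  exp-0   : EA (exp Z ≐ 𝟏)
  exp-suc : EA (∀̇ exp (𝐒 (var zero)) ≐ exp (var zero) ⊕ exp (var zero))
  ind     : ∀ {n} {φ : Formula Lᵉˣᵖ (suc n)} → Bounded φ →
            EA (∀closure n (φ [ Z ] ∧̇ ∀̇ (φ ⇒̇ φ at 𝐒 (var zero)) ⇒̇ ∀̇ φ))

-- Provable arithmetical sentences are true.
Sound : ∀ {L} → Theory L → Set
Sound S = ∀ (φ : Sentence Lᵇ) → S ⊢ lift φ → ℕ⊨ φ

FinitelyAxiomatized : ∀ {L} → Theory L → Set
FinitelyAxiomatized S = ∃[ axioms ] ∀ φ → S φ ⇔ φ ∈ axioms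

-- Direct interpretation of adjunctive set theory, E(a,b) being "a ∈ b".
Sequential : ∀ {L} → Theory L → Set
Sequential {L} S = Σ (Formula L 2) λ E →
  (S ⊢ ∃̇ ∀̇ ¬̇ E)
  × (S ⊢ ∀̇ ∀̇ ∃̇ ∀̇ (E ⟨ u ∷ z ∷ [] ⟩ ⇔̇ (E ⟨ u ∷ y ∷ [] ⟩ ∨̇ u ≐ x)))
  where
  x y z u : Term L 4
  x = var (suc (suc (suc zero)))
  y = var (suc (suc zero))
  z = var (suc zero)
  u = var zero

ExtendsS¹₂ : ∀ {L} → Theory L → Set
ExtendsS¹₂ S = ∀ {φ} → S¹₂ φ → S ⊢ lift φ

PolyTimeAxioms : ∀ {L} → Theory L → Set
PolyTimeAxioms S = PolyTimeDecidable (λ w → ∃[ φ ] (S φ × w ≡ bits (write φ)))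

-- run(p,x,h): h codes a halting computation of U on p with output x.
record UArithmetization (U : TM) : Set where
  field
    run         : Formula Lᵇ 3
    run-bounded : Bounded run

  outputs : Formula Lᵇ 2
  outputs = ∃̇ (run ⟨ var (suc zero) ∷ var (suc (suc zero)) ∷ var zero ∷ [] ⟩)

  field
    outputs-correct : ∀ p x →
      (p ∷ x ∷ [] ⊨ outputs) ⇔ (∃[ w ] ∃[ y ] (p ≡ code w × x ≡ code y × U on w ⇓ y))

-- For numbers p, x coding strings w, y one has 1#p = 2^(|w|+1),
-- 1#x = 2^(|y|+1) and |⌊x/2⌋| = |y|, so the inequality says
-- 2^|y| ≤ 2^|w| · |y|^d.
inR : ∀ {U} → UArithmetization U → ℕ → Str → Sentence Lᵇ
inR 𝒰 d x =
  ∀̇ (outputs ⟨ var zero ∷ x̄ ∷ [] ⟩ ⇒̇ 𝟏 ♯ x̄ ≼ (𝟏 ♯ var zero) ∙ (∣ ½ x̄ ∣ ^̇ d))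
  where
  open UArithmetization 𝒰
  x̄ : Term Lᵇ 1
  x̄ = num (code x)

Δᵇ₁-in-S¹₂ : ∀ {n} → Formula Lᵇ n → Set
Δᵇ₁-in-S¹₂ {n} φ = Σᵇ₁ φ × ∃[ ψ ] (Πᵇ₁ ψ × S¹₂ ⊢ ∀closure n (φ ⇔̇ ψ))

Proves : ∀ {L} → Theory L → ℕ → ℕ → Set
Proves T p a = ∃[ Γ ] ∃[ φ ] (IsProof T φ Γ × p ≡ gödel (writeProof Γ) × a ≡ ⌜ φ ⌝)

-- Arithmetized proof predicates: prf(p,a) for "p is an S-proof of a", and
-- prf⁺(p,a,e) for "p is a proof of a in S plus the sentence e".
record ProofPredicates {L : Language} (S : Theory L) : Set where
  field
    prf          : Formula Lᵇ 2
    prf-Δ        : Δᵇ₁-in-S¹₂ prf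
    prf-correct  : ∀ p a → (p ∷ a ∷ [] ⊨ prf) ⇔ Proves S p a
    prf⁺         : Formula Lᵇ 3
    prf⁺-Δ       : Δᵇ₁-in-S¹₂ prf⁺
    prf⁺-correct : ∀ p a (θ : Sentence L) →
                   (p ∷ a ∷ ⌜ θ ⌝ ∷ [] ⊨ prf⁺) ⇔ Proves (S ⊕ᵀ θ) p a

contradiction : ∀ {L} → Sentence L
contradiction = Z ≐ 𝟏

-- A symbol takes four bits, so a text of ℓ symbols has a code of
-- bit length 4ℓ + 1.
lengthAtMost : ∀ {m} → Term Lᵇ m → ℕ → Formula Lᵇ m
lengthAtMost p n = ∣ p ∣ ≼ num (4 * n + 1)

module _ {L : Language} {S : Theory L} (P : ProofPredicates S) where
  open ProofPredicates P

  private
    refutes : Formula Lᵇ 1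
    refutes = prf ⟨ var zero ∷ num ⌜ contradiction {L} ⌝ ∷ [] ⟩

    refutes⁺ : Sentence L → Formula Lᵇ 1
    refutes⁺ θ = prf⁺ ⟨ var zero ∷ num ⌜ contradiction {L} ⌝ ∷ num ⌜ θ ⌝ ∷ [] ⟩

  Con : Sentence Lᵇ
  Con = ∀̇ ¬̇ refutes

  Con≤ : ℕ → Sentence Lᵇ
  Con≤ n = ∀̇ (lengthAtMost (var zero) n ⇒̇ ¬̇ refutes)

  Con⁺ : Sentence L → Sentence Lᵇ
  Con⁺ θ = ∀̇ ¬̇ refutes⁺ θ

  Con⁺≤ : Sentence L → ℕ → Sentence Lᵇ
  Con⁺≤ θ n = ∀̇ (lengthAtMost (var zero) n ⇒̇ ¬̇ refutes⁺ θ)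

PolySizeProofs : ∀ {L} → Theory L → (ℕ → Sentence L) → Set
PolySizeProofs S θ = ∃[ c ] ∃[ n₀ ] ∀ n → n₀ ≤ n → S ⊢[≤ n ^ c ] θ n

module _ {U : TM} (𝒰 : UArithmetization U) (d : ℕ)
         {L : Language} {S : Theory L} (P : ProofPredicates S) where

  ConR : Str → Sentence Lᵇ
  ConR x = Con⁺ P (lift (inR 𝒰 d x))

  ConR≤ : Str → ℕ → Sentence Lᵇ
  ConR≤ x = Con⁺≤ P (lift (inR 𝒰 d x))

  EA-RelativeConsistency : Str → Set
  EA-RelativeConsistency x = EA ⊢ lift (Con P ⇒̇ ConR x)

  C-rel : Str → Set
  C-rel x = InR U d x × EA-RelativeConsistency x

  ExceedsC-rel : ℕ → Set
  ExceedsC-rel k = ∀ x → C-rel x → length x < k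

  SETH-K-Finite : ℕ → Set₁
  SETH-K-Finite k = ∀ m → k < m → ∀ (ε : ℝ) → 0< ε → ε <1 →
    ∃[ N ] ∀ x → InR U d x → length x ≡ m → ∀ n → N < n →
      (S ⊢[≤2^[1- ε ]· n ] lift (ConR≤ x n)) ⇔ EA-RelativeConsistency x

data PropFormula : Set where
  atom     : ℕ → PropFormula
  not      : PropFormula → PropFormula
  conj disj : PropFormula → PropFormula → PropFormula

Satisfies : (ℕ → Bool) → PropFormula → Set
Satisfies α (atom i)   = α i ≡ true
Satisfies α (not A)    = ¬ Satisfies α A
Satisfies α (conj A B) = Satisfies α A × Satisfies α B
Satisfies α (disj A B) = Satisfies α A ⊎ Satisfies α B

Tautology : PropFormula → Set
Tautology A = ∀ α → Satisfies α A

writeᴾ : PropFormula → List Symbol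
writeᴾ (atom i)   = var ∷ digits i
writeᴾ (not A)    = neg ∷ writeᴾ A
writeᴾ (conj A B) = and ∷ writeᴾ A ++ writeᴾ B
writeᴾ (disj A B) = or ∷ writeᴾ A ++ writeᴾ B

propSize : PropFormula → ℕ
propSize A = length (writeᴾ A)

-- The bound (m+n)^b is imposed only for m+n ≥ 2, where powers of m+n
-- dominate all polynomials in m+n.
record PropTranslation (θ : Str → ℕ → Sentence Lᵇ) : Set where
  field
    τ        : Str → ℕ → PropFormula
    polytime : PolyTimeComputable {Str × ℕ}
                 (λ (x , n) → pair x (unary n)) (λ (x , n) → bits (writeᴾ (τ x n)))
    polysize : ∃[ b ] ∀ x n → 2 ≤ length x + n → propSize (τ x n) ≤ (length x + n) ^ b
    correct  : ∀ x n → Tautology (τ x n) ⇔ (ℕ⊨ θ x n)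

record TautologyPredicate : Set where
  field
    taut         : Formula Lᵇ 1
    taut-Π       : Πᵇ₁ taut
    taut-correct : ∀ A → (gödel (writeᴾ A) ∷ [] ⊨ taut) ⇔ Tautology A

-- The proof system associated with S: a proof of A is an S-proof of the
-- arithmetical sentence "A is a tautology", and its size is the
-- length of that S-proof.
IsPropProof : ∀ {L} → TautologyPredicate → Theory L → PropFormula → List (Line L) → Set
IsPropProof 𝒯 S A = IsProof S (lift (taut ⟨ num (gödel (writeᴾ A)) ∷ [] ⟩))
  where open TautologyPredicate 𝒯

-- As in PropTranslation, the bound is imposed only for m+n ≥ 2.
Correspondence : ∀ {L} → TautologyPredicate → Theory L →
                 (θ : Str → ℕ → Sentence Lᵇ) → PropTranslation θ → ℕ → Set
Correspondence {L} 𝒯 S θ 𝒫 a =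
  Σ (Str → ℕ → Str → Str) λ carry →
    PolyTimeComputable {Str × ℕ × Str}
      (λ (x , n , π) → pair x (pair (unary n) π)) (λ (x , n , π) → carry x n π)
    × (∀ x n (Γ : List (Line L)) → 2 ≤ length x + n → IsPropProof 𝒯 S (τ x n) Γ →
        ∃[ Δ ] (IsProof S (lift (θ x n)) Δ
          × carry x n (bits (writeProof Γ)) ≡ bits (writeProof Δ)
          × proofSize Δ ≤ proofSize Γ * (length x + n) ^ a))
  where open PropTranslation 𝒫

RequiresProofSize>2^[1-_]· : ∀ {L} → ℝ → ℕ → TautologyPredicate → Theory L → PropFormula → Set
RequiresProofSize>2^[1-_]· ε n 𝒯 S A =
  ∀ Γ → IsPropProof 𝒯 S A Γ → proofSize Γ >2^[1- ε ]· n

-- At least (1 - C/m^d) · 2^m strings of length m satisfy Q.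
AtLeast[1-_/_^_]2^ : ℕ → (m d : ℕ) → (Str → Set) → Set
AtLeast[1- C / m ^ d ]2^ Q =
  Σ (List Str) λ xs →
    Unique xs × All (λ x → length x ≡ m × Q x) xs
    × 2 ^ m * m ^ d ≤ length xs * m ^ d + C * 2 ^ m

{-# OPTIONS --safe #-}
-- A random string x of length m > k is not in C_rel, so SETH-K-Finite, applied to a smaller rational
-- ε' = 1/(2B) where A/B is a rational in (0, ε), excludes 𝒮-proofs of Con(n) of size at most 2^((1-ε')n).
-- The correspondence costs a factor (m+n)^a, which is below 2^(n/(2B)) for large n, so a propositional
-- proof of size at most 2^((1-ε)n) would be carried to such an excluded proof.
--
-- τ is a tautology since 𝒮 + (x ∈ R) is consistent: by the deduction theorem an inconsistency would give
-- 𝒮 ⊢ (x ∈ R) ⇒ 0 = 1, contradicting soundness as x ∈ R is true.  The strings of length m outside R have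
-- distinct programs p with 2^|p| m^d < 2^m, of which there are at most 2·2^m / m^d.
module Submission where

open import Defs
open import Axiom.ExcludedMiddle using (ExcludedMiddle)
open import Level using (0ℓ)
open import Data.Bool using (Bool; true; false)
open import Data.Fin using (Fin; zero; suc)
open import Data.Integer as ℤ using (+<+)
open import Data.Integer.Properties as ℤ using ()
open import Data.List using (List; []; _∷_; _++_; length; map; filter; foldl)
open import Data.List.Properties using (length-++; length-map; ∷-injectiveʳ; ++-identityʳ)
open import Data.List.Membership.Propositional using (_∈_)
open import Data.List.Membership.Propositional.Properties
  using (∈-∃++; ∈-++⁺ˡ; ∈-++⁺ʳ; ∈-++⁻; ∈-map⁺; ∈-map⁻; ∈-filter⁻)
open import Data.List.Relation.Unary.All as All using (All; [])
open import Data.List.Relation.Unary.AllPairs using ([]; _∷_)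
open import Data.List.Relation.Unary.Any using (here; there)
open import Data.List.Relation.Unary.Unique.Propositional using (Unique)
open import Data.List.Relation.Unary.Unique.Propositional.Properties as Unique using ()
open import Data.Nat
open import Data.Nat.Binary as ℕᵇ using (2[1+_]; 1+[2_]; fromℕ)
open import Data.Nat.Binary.Properties as ℕᵇ using ()
open import Data.Nat.DivMod using (_/_; _%_; m≡m%n+[m/n]*n; m%n<n; m/n*n≤m)
open import Data.Nat.Induction using (<-wellFounded)
open import Data.Nat.Logarithm using (⌈log₂⌉-mono-≤; ⌈log₂⌈n/2⌉⌉≡⌈log₂n⌉∸1)
open import Data.Nat.Properties
open import Data.Nat.Tactic.RingSolver using (solve-∀)
open import Data.Product using (Σ; ∃-syntax; _×_; _,_; proj₁; proj₂)
open import Data.Product.Function.NonDependent.Propositional using (_×-⇔_)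
open import Data.Rational.Unnormalised as ℚᵘ using (ℚᵘ; mkℚᵘ; 0ℚᵘ; 1ℚᵘ; *<*)
open import Data.Rational.Unnormalised.Properties as ℚᵘ using ()
open import Data.Sum using (_⊎_; inj₁; inj₂)
open import Data.Sum.Function.Propositional using (_⊎-⇔_)
open import Data.Vec as Vec using (Vec; []; _∷_)
open import Function using (_∘_)
open import Function.Bundles using (_⇔_; mk⇔; module Equivalence)
open import Induction.WellFounded using (Acc; acc)
open import Relation.Binary.PropositionalEquality
  using (_≡_; refl; sym; trans; cong; cong₂; module ≡-Reasoning)
  renaming (subst to transport)
open import Relation.Nullary using (¬_; yes; no) renaming (contradiction to absurd)
open import Relation.Unary using (Decidable)

open Equivalence using (to; from)

-- Growth of polynomials and exponentials

*-^-distrib : ∀ a b n → (a * b) ^ n ≡ a ^ n * b ^ n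
*-^-distrib a b zero    = refl
*-^-distrib a b (suc n) = begin
  a * b * (a * b) ^ n       ≡⟨ cong (a * b *_) (*-^-distrib a b n) ⟩
  a * b * (a ^ n * b ^ n)   ≡⟨ interchange a b (a ^ n) (b ^ n) ⟩
  a * a ^ n * (b * b ^ n)   ∎
  where
  open ≡-Reasoning
  interchange : ∀ a b c d → a * b * (c * d) ≡ a * c * (b * d)
  interchange = solve-∀

^-cancelˡ-≤ : ∀ a b n .{{_ : NonZero n}} → a ^ n ≤ b ^ n → a ≤ b
^-cancelˡ-≤ a b n aⁿ≤bⁿ with a ≤? b
... | yes a≤b = a≤b
... | no  a≰b = absurd aⁿ≤bⁿ (<⇒≱ (^-monoˡ-< n (≰⇒> a≰b)))

n<2^n : ∀ n → n < 2 ^ n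
n<2^n zero    = s≤s z≤n
n<2^n (suc n) = begin-strict
  suc n           ≤⟨ n<2^n n ⟩
  2 ^ n           <⟨ m<m+n (2 ^ n) (m^n>0 2 n) ⟩
  2 ^ n + 2 ^ n   ≡⟨ cong (2 ^ n +_) (sym (+-identityʳ (2 ^ n))) ⟩
  2 ^ suc n       ∎
  where open ≤-Reasoning

-- With x = e t + r and r < e one has x ≤ e (t + 1) ≤ e 2^t.
x^e≤e^e*2^x : ∀ e x .{{_ : NonZero e}} → x ^ e ≤ e ^ e * 2 ^ x
x^e≤e^e*2^x e x = begin
  x ^ e                 ≤⟨ ^-monoˡ-≤ e x≤e*2^t ⟩
  (e * 2 ^ t) ^ e       ≡⟨ *-^-distrib e (2 ^ t) e ⟩
  e ^ e * (2 ^ t) ^ e   ≡⟨ cong (e ^ e *_) (^-*-assoc 2 t e) ⟩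
  e ^ e * 2 ^ (t * e)   ≤⟨ *-monoʳ-≤ (e ^ e) (^-monoʳ-≤ 2 (m/n*n≤m x e)) ⟩
  e ^ e * 2 ^ x         ∎
  where
  open ≤-Reasoning
  t = x / e
  x≤e*2^t : x ≤ e * 2 ^ t
  x≤e*2^t = begin
    x               ≡⟨ m≡m%n+[m/n]*n x e ⟩
    x % e + t * e   ≤⟨ +-monoˡ-≤ (t * e) (<⇒≤ (m%n<n x e)) ⟩
    suc t * e       ≤⟨ *-monoˡ-≤ e (n<2^n t) ⟩
    2 ^ t * e       ≡⟨ *-comm (2 ^ t) e ⟩
    e * 2 ^ t       ∎

polynomial≤2^n : ∀ m e → ∃[ N ] ∀ n → N < n → (m + n) ^ e ≤ 2 ^ n
polynomial≤2^n m e = N , bound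
  where
  open ≤-Reasoning
  K N : ℕ
  K = suc e ^ suc e
  N = K * 2 ^ m
  bound : ∀ n → N < n → (m + n) ^ e ≤ 2 ^ n
  bound n@(suc _) N<n = *-cancelˡ-≤ n (begin
    -- One more factor m + n than the claim asks for: for n > N the spare n pays for the constant
    -- `K * 2 ^ m`.
    n * (m + n) ^ e       ≤⟨ *-monoˡ-≤ ((m + n) ^ e) (m≤n+m n m) ⟩
    (m + n) ^ suc e       ≤⟨ x^e≤e^e*2^x (suc e) (m + n) ⟩
    K * 2 ^ (m + n)       ≡⟨ cong (K *_) (^-distribˡ-+-* 2 m n) ⟩
    K * (2 ^ m * 2 ^ n)   ≡⟨ sym (*-assoc K (2 ^ m) (2 ^ n)) ⟩
    N * 2 ^ n             ≤⟨ *-monoˡ-≤ (2 ^ n) (<⇒≤ N<n) ⟩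
    n * 2 ^ n             ∎)

-- Rational cuts and bounds of the form 2^((1-ε)n)

fromℚᵘ : ℚᵘ → ℝ
fromℚᵘ q = record
  { Lower         = ℚᵘ._< q
  ; Upper         = q ℚᵘ.<_
  ; lower-inhab   = q ℚᵘ.- 1ℚᵘ , ℚᵘ.<-respʳ-≃ (ℚᵘ.+-identityʳ q) (ℚᵘ.+-monoʳ-< q (ℚᵘ.negative⁻¹ (ℚᵘ.- 1ℚᵘ)))
  ; upper-inhab   = q ℚᵘ.+ 1ℚᵘ , ℚᵘ.<-respˡ-≃ (ℚᵘ.+-identityʳ q) (ℚᵘ.+-monoʳ-< q (ℚᵘ.positive⁻¹ 1ℚᵘ))
  ; lower-rounded = λ p → mk⇔ (λ p<q → ℚᵘ.<-dense p<q) (λ (r , p<r , r<q) → ℚᵘ.<-trans p<r r<q)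
  ; upper-rounded = λ p → mk⇔ (λ q<p → let r , q<r , r<p = ℚᵘ.<-dense q<p in r , r<p , q<r)
                              (λ (r , r<p , q<r) → ℚᵘ.<-trans q<r r<p)
  ; disjoint      = λ p (p<q , q<p) → ℚᵘ.<-asym p<q q<p
  ; located       = located
  }
  where
  located : ∀ p r → p ℚᵘ.< r → p ℚᵘ.< q ⊎ q ℚᵘ.< r
  located p r p<r with p ℚᵘ.<? q
  ... | yes p<q = inj₁ p<q
  ... | no  p≮q = inj₂ (ℚᵘ.≤-<-trans (ℚᵘ.≮⇒≥ p≮q) p<r)

-- Roundedness of the lower cut moves from 0 to a rational strictly between 0 and ε, whose numerator
-- is therefore a successor.
positive-lower : ∀ ε → 0< ε → ∃[ a ] ∃[ b ] (suc a /1+ b <ℝ ε)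
positive-lower ε 0<ε with to (ℝ.lower-rounded ε 0ℚᵘ) 0<ε
... | mkℚᵘ (ℤ.+ suc a) b , _ , q<ε = a , b , q<ε
... | mkℚᵘ (ℤ.+ zero) b , *<* (+<+ ()) , _
... | mkℚᵘ (ℤ.-[1+ _ ]) b , *<* () , _

module _ (b₀ : ℕ) where
  private
    B D : ℕ
    B = suc b₀
    -- This is 2B in the shape of the denominator of the rational defining `halfReciprocal`.
    D = suc (b₀ + B)
    D≡B*2 : D ≡ B * 2
    D≡B*2 = double b₀
      where
      double : ∀ b → suc (b + suc b) ≡ suc b * 2
      double = solve-∀

  -- The number 1/(2B).
  halfReciprocal : ℝ
  halfReciprocal = fromℚᵘ (mkℚᵘ (ℤ.+ 1) (b₀ + B))

  0<halfReciprocal : 0< halfReciprocal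
  0<halfReciprocal = ℚᵘ.positive⁻¹ _

  halfReciprocal<1 : halfReciprocal <1
  halfReciprocal<1 = *<* (+<+ (s≤s (transport (1 ≤_) (sym (trans (+-identityʳ (b₀ + B)) (+-suc b₀ b₀))) (s≤s z≤n))))

  -- With X = s P and D = 2B the hypotheses give X^D 2^n ≤ 2^(D n); the claim for a/C < 1/D
  -- follows by raising this to the power C and extracting D-th roots.
  absorb-polynomial : ∀ s P n → s ^ B * 2 ^ n ≤ 2 ^ (B * n) → P ^ D ≤ 2 ^ n →
                      (s * P) ≤2^[1- halfReciprocal ]· n
  absorb-polynomial s P n s≤ P≤ a c (*<* a/c<1/D) = ^-cancelˡ-≤ _ _ D (begin
    (X ^ C * 2 ^ (a * n)) ^ D          ≡⟨ *-^-distrib (X ^ C) (2 ^ (a * n)) D ⟩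
    (X ^ C) ^ D * (2 ^ (a * n)) ^ D    ≡⟨ cong₂ _*_ swap-exponents (^-*-assoc 2 (a * n) D) ⟩
    (X ^ D) ^ C * 2 ^ (a * n * D)      ≤⟨ *-monoʳ-≤ ((X ^ D) ^ C) (^-monoʳ-≤ 2 anD≤nC) ⟩
    (X ^ D) ^ C * 2 ^ (n * C)          ≡⟨ cong ((X ^ D) ^ C *_) (sym (^-*-assoc 2 n C)) ⟩
    (X ^ D) ^ C * (2 ^ n) ^ C          ≡⟨ sym (*-^-distrib (X ^ D) (2 ^ n) C) ⟩
    (X ^ D * 2 ^ n) ^ C                ≤⟨ ^-monoˡ-≤ C X^D≤ ⟩
    (2 ^ (D * n)) ^ C                  ≡⟨ ^-*-assoc 2 (D * n) C ⟩
    2 ^ (D * n * C)                    ≡⟨ cong (2 ^_) (rearrange D n C) ⟩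
    2 ^ (C * n * D)                    ≡⟨ sym (^-*-assoc 2 (C * n) D) ⟩
    (2 ^ (C * n)) ^ D                  ∎)
    where
    open ≤-Reasoning
    X C : ℕ
    X = s * P
    C = suc c
    swap-exponents : (X ^ C) ^ D ≡ (X ^ D) ^ C
    swap-exponents = trans (^-*-assoc X C D) (trans (cong (X ^_) (*-comm C D)) (sym (^-*-assoc X D C)))
    rearrange : ∀ D n C → D * n * C ≡ C * n * D
    rearrange = solve-∀
    -- The order of `ℚᵘ` is cross multiplication, so a/C < 1/D unfolds to this inequality up to
    -- coercions.
    aD<C : a * D < C
    aD<C = ℤ.drop‿+<+ (transport (ℤ._< ℤ.+ C) (sym (ℤ.pos-* a D))
             (transport (ℤ.+ a ℤ.* ℤ.+ D ℤ.<_) (ℤ.*-identityˡ (ℤ.+ C)) a/c<1/D))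
    anD≤nC : a * n * D ≤ n * C
    anD≤nC = begin
      a * n * D     ≡⟨ cong (_* D) (*-comm a n) ⟩
      n * a * D     ≡⟨ *-assoc n a D ⟩
      n * (a * D)   ≤⟨ *-monoʳ-≤ n (<⇒≤ aD<C) ⟩
      n * C         ∎
    swap-last : ∀ b n c → b * n * c ≡ b * c * n
    swap-last = solve-∀
    -- The factor 2^n that bounds P^D and the given 2^n together are the square of the 2^n in the
    -- hypothesis on s, which is then squared.
    X^D≤ : X ^ D * 2 ^ n ≤ 2 ^ (D * n)
    X^D≤ = begin
      X ^ D * 2 ^ n                  ≡⟨ cong (_* 2 ^ n) (*-^-distrib s P D) ⟩
      s ^ D * P ^ D * 2 ^ n          ≤⟨ *-monoˡ-≤ (2 ^ n) (*-monoʳ-≤ (s ^ D) P≤) ⟩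
      s ^ D * 2 ^ n * 2 ^ n          ≡⟨ *-assoc (s ^ D) (2 ^ n) (2 ^ n) ⟩
      s ^ D * (2 ^ n * 2 ^ n)        ≡⟨ cong₂ _*_ (trans (cong (s ^_) D≡B*2) (sym (^-*-assoc s B 2)))
                                                  (cong (2 ^ n *_) (sym (*-identityʳ (2 ^ n)))) ⟩
      (s ^ B) ^ 2 * (2 ^ n) ^ 2      ≡⟨ sym (*-^-distrib (s ^ B) (2 ^ n) 2) ⟩
      (s ^ B * 2 ^ n) ^ 2            ≤⟨ ^-monoˡ-≤ 2 s≤ ⟩
      (2 ^ (B * n)) ^ 2              ≡⟨ ^-*-assoc 2 (B * n) 2 ⟩
      2 ^ (B * n * 2)                ≡⟨ cong (2 ^_) (trans (swap-last B n 2) (cong (_* n) (sym D≡B*2))) ⟩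
      2 ^ (D * n)                    ∎

-- Here s is the size of a propositional proof, P the overhead of the correspondence and ℓ the size
-- of the carried proof. One rational below ε decides the matter: either it witnesses that s is
-- large, or s is small enough to absorb P, and then ℓ is small.
size-transfer : ∀ ε {a b} → suc a /1+ b <ℝ ε → ∀ n {ℓ s P} → P ^ suc (b + suc b) ≤ 2 ^ n → ℓ ≤ s * P →
                ¬ (ℓ ≤2^[1- halfReciprocal b ]· n) → s >2^[1- ε ]· n
size-transfer ε {a} {b} q<ε n {ℓ} {s} {P} P≤ ℓ≤ ℓ-large with 2 ^ (suc b * n) <? s ^ suc b * 2 ^ (suc a * n)
... | yes s-large  = suc a , b , q<ε , s-large
... | no  ¬s-large = absurd ℓ-small ℓ-large
  where
  -- The numerator `suc a` is lowered to 1, leaving the margin between 1/B and 1/(2B) for P.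
  s-small : s ^ suc b * 2 ^ n ≤ 2 ^ (suc b * n)
  s-small = ≤-trans (*-monoʳ-≤ (s ^ suc b) (^-monoʳ-≤ 2 (m≤m+n n (a * n)))) (≮⇒≥ ¬s-large)
  ℓ-small : ℓ ≤2^[1- halfReciprocal b ]· n
  ℓ-small α c α/c<1/D = ≤-trans (*-monoˡ-≤ (2 ^ (α * n)) (^-monoˡ-≤ (suc c) ℓ≤))
                                (absorb-polynomial b s P n s-small P≤ α c α/c<1/D)

-- Random strings

HaltsFrom-functional : ∀ M {c t t′ y y′} → TM.HaltsFrom M c t y → TM.HaltsFrom M c t′ y′ → y ≡ y′
HaltsFrom-functional M {t = zero}  {zero}   (_ , o) (_ , o′) = trans (sym o) o′
HaltsFrom-functional M {t = zero}  {suc _}  (h , _) (_ , s , _) = absurd (trans (sym h) s) λ ()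
HaltsFrom-functional M {t = suc _} {zero}   (_ , s , _) (h , _) = absurd (trans (sym h) s) λ ()
HaltsFrom-functional M {t = suc _} {suc _}  (_ , s , r) (_ , s′ , r′) with trans (sym s) s′
... | refl = HaltsFrom-functional M r r′

⇓-functional : ∀ U {p x y} → U on p ⇓ x → U on p ⇓ y → x ≡ y
⇓-functional U (_ , h) (_ , h′) = HaltsFrom-functional U h h′

module _ {A B : Set} {R : B → A → Set} (functional : ∀ {b x y} → R b x → R b y → x ≡ y) where

  -- A pigeonhole argument: the witness b of the head is removed from `bs`, and the tail is still
  -- covered because b is related to nothing but the head.
  length-≤-via : ∀ {xs} bs → Unique xs → (∀ {x} → x ∈ xs → ∃[ b ] (b ∈ bs × R b x)) →
                 length xs ≤ length bs
  length-≤-via bs [] _ = z≤n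
  length-≤-via bs (x∉xs ∷ unique) cover with cover (here refl)
  ... | b , b∈bs , Rbx with ∈-∃++ b∈bs
  ...   | ls , rs , refl = begin
    suc _                          ≤⟨ s≤s (length-≤-via (ls ++ rs) unique cover′) ⟩
    suc (length (ls ++ rs))        ≡⟨ cong suc (length-++ ls) ⟩
    suc (length ls + length rs)    ≡⟨ sym (+-suc (length ls) (length rs)) ⟩
    length ls + suc (length rs)    ≡⟨ sym (length-++ ls) ⟩
    length (ls ++ b ∷ rs)          ∎
    where
    open ≤-Reasoning
    cover′ : ∀ {y} → y ∈ _ → ∃[ c ] (c ∈ ls ++ rs × R c y)
    cover′ y∈xs with cover (there y∈xs)
    ... | c , c∈bs , Rcy with ∈-++⁻ ls c∈bs
    ...   | inj₁ c∈ls         = c , ∈-++⁺ˡ c∈ls , Rcy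
    -- The removed b would relate to both the head and a member of the tail, making them equal
    -- against uniqueness.
    ...   | inj₂ (here refl)  = absurd (functional Rbx Rcy) (All.lookup x∉xs y∈xs)
    ...   | inj₂ (there c∈rs) = c , ∈-++⁺ʳ ls c∈rs , Rcy

length-filter-+ : ∀ {A : Set} {P Q : A → Set} (P? : Decidable P) (Q? : Decidable Q) →
                  (∀ {x} → ¬ P x → Q x) → ∀ xs →
                  length xs ≤ length (filter P? xs) + length (filter Q? xs)
length-filter-+ P? Q? ¬P⇒Q [] = z≤n
length-filter-+ P? Q? ¬P⇒Q (x ∷ xs) with length-filter-+ P? Q? ¬P⇒Q xs | P? x | Q? x
... | ih | yes _ | yes _ = s≤s (≤-trans ih (+-monoʳ-≤ _ (n≤1+n _)))
... | ih | yes _ | no _  = s≤s ih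
... | ih | no _  | yes _ = ≤-trans (s≤s ih) (≤-reflexive (sym (+-suc _ _)))
... | ih | no ¬p | no ¬q = absurd (¬P⇒Q ¬p) ¬q

map∷-disjoint : ∀ {xss yss : List Str} {z} → ¬ (z ∈ map (false ∷_) xss × z ∈ map (true ∷_) yss)
map∷-disjoint (i , j) with ∈-map⁻ (false ∷_) i | ∈-map⁻ (true ∷_) j
... | _ , _ , refl | _ , _ , ()

strings : ℕ → List Str
strings zero    = [] ∷ []
strings (suc m) = map (false ∷_) (strings m) ++ map (true ∷_) (strings m)

length-branch : ∀ (xss : List Str) → length (map (false ∷_) xss ++ map (true ∷_) xss) ≡ 2 * length xss
length-branch xss = begin
  length (map (false ∷_) xss ++ map (true ∷_) xss)          ≡⟨ length-++ (map (false ∷_) xss) ⟩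
  length (map (false ∷_) xss) + length (map (true ∷_) xss)  ≡⟨ cong₂ _+_ (length-map _ xss)
                                                                       (trans (length-map _ xss) (sym (+-identityʳ _))) ⟩
  2 * length xss                                            ∎
  where open ≡-Reasoning

length-strings : ∀ m → length (strings m) ≡ 2 ^ m
length-strings zero    = refl
length-strings (suc m) = trans (length-branch (strings m)) (cong (2 *_) (length-strings m))

strings-unique : ∀ m → Unique (strings m)
strings-unique zero    = [] ∷ []
strings-unique (suc m) =
  Unique.++⁺ (Unique.map⁺ ∷-injectiveʳ (strings-unique m)) (Unique.map⁺ ∷-injectiveʳ (strings-unique m))
             map∷-disjoint

strings-length : ∀ m → All (λ x → length x ≡ m) (strings m)
strings-length m = All.tabulate (go m)
  where
  go : ∀ m {x} → x ∈ strings m → length x ≡ m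
  go zero (here refl) = refl
  go (suc m) i with ∈-++⁻ (map (false ∷_) (strings m)) i
  ... | inj₁ j with ∈-map⁻ (false ∷_) j
  ...   | _ , k , refl = cong suc (go m k)
  go (suc m) i | inj₂ j with ∈-map⁻ (true ∷_) j
  ...   | _ , k , refl = cong suc (go m k)

shorter : ℕ → List Str
shorter zero    = []
shorter (suc k) = [] ∷ map (false ∷_) (shorter k) ++ map (true ∷_) (shorter k)

length-shorter : ∀ k → length (shorter k) < 2 ^ k
length-shorter zero    = s≤s z≤n
length-shorter (suc k) = begin
  suc (suc (length (map (false ∷_) (shorter k) ++ map (true ∷_) (shorter k)))) ≡⟨ cong (2 +_) (length-branch (shorter k)) ⟩
  2 + 2 * length (shorter k)   ≡⟨ sym (*-suc 2 (length (shorter k))) ⟩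
  2 * suc (length (shorter k)) ≤⟨ *-monoʳ-≤ 2 (length-shorter k) ⟩
  2 ^ suc k                    ∎
  where open ≤-Reasoning

∈-shorter : ∀ {k} p → length p < k → p ∈ shorter k
∈-shorter {suc k} []          _       = here refl
∈-shorter {suc k} (false ∷ p) (s≤s l) = there (∈-++⁺ˡ (∈-map⁺ _ (∈-shorter p l)))
∈-shorter {suc k} (true ∷ p)  (s≤s l) = there (∈-++⁺ʳ (map (false ∷_) (shorter k)) (∈-map⁺ _ (∈-shorter p l)))

-- The bound k descends from m and stops at 0 or once k - 1 satisfies 2^(k-1) q < 2^m. In the latter
-- case the fewer than 2^k shorter strings number at most 2·2^m / q; this is the source of the
-- factor 2.
few-short-strings : ∀ q m → 1 ≤ q →
  ∃[ k ] ((∀ j → 2 ^ j * q < 2 ^ m → j < k) × length (shorter k) * q ≤ 2 * 2 ^ m)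
few-short-strings q m 1≤q = search m bounded-by-m
  where
  open ≤-Reasoning
  bounded-by-m : ∀ j → 2 ^ j * q < 2 ^ m → j < m
  bounded-by-m j lt with j <? m
  ... | yes j<m = j<m
  ... | no  j≮m = absurd lt (≤⇒≯ (begin
    2 ^ m       ≤⟨ ^-monoʳ-≤ 2 (≮⇒≥ j≮m) ⟩
    2 ^ j       ≡⟨ sym (*-identityʳ (2 ^ j)) ⟩
    2 ^ j * 1   ≤⟨ *-monoʳ-≤ (2 ^ j) 1≤q ⟩
    2 ^ j * q   ∎))
  search : ∀ i → (∀ j → 2 ^ j * q < 2 ^ m → j < i) →
           ∃[ k ] ((∀ j → 2 ^ j * q < 2 ^ m → j < k) × length (shorter k) * q ≤ 2 * 2 ^ m)
  search zero    b = zero , b , z≤n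
  search (suc i) b with 2 ^ i * q <? 2 ^ m
  ... | yes lt = suc i , b , (begin
    length (shorter (suc i)) * q   ≤⟨ *-monoˡ-≤ q (<⇒≤ (length-shorter (suc i))) ⟩
    2 * 2 ^ i * q                  ≡⟨ *-assoc 2 (2 ^ i) q ⟩
    2 * (2 ^ i * q)                ≤⟨ *-monoʳ-≤ 2 (<⇒≤ lt) ⟩
    2 * 2 ^ m                      ∎)
  ... | no nlt = search i λ j lt → ≤∧≢⇒< (≤-pred (b j lt)) λ { refl → nlt lt }

module _ (em : ExcludedMiddle 0ℓ) where

  -- Supplies a shortest program; halting is undecidable, so the descent consults `em`.
  least-element : ∀ (P : ℕ → Set) n → P n → ∃[ k ] (P k × ∀ j → P j → k ≤ j)
  least-element P n = go n (<-wellFounded n)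
    where
    go : ∀ n → Acc _<_ n → P n → ∃[ k ] (P k × ∀ j → P j → k ≤ j)
    go n (acc smaller) pn with em {∃[ j ] (j < n × P j)}
    ... | yes (j , j<n , pj) = go j (smaller j<n) pj
    ... | no  none           = n , pn , λ j pj → ≮⇒≥ λ j<n → none (j , j<n , pj)

  -- `InR` speaks of the exact complexity only; a shortest program exists and is no longer than p,
  -- so its bound passes to p.
  InR-bound : ∀ {U d x} → InR U d x → ∀ {p} → U on p ⇓ x →
              2 ^ length x ≤ 2 ^ length p * length x ^ d
  InR-bound {U} {d} {x} x∈R {p} p⇓x
    with least-element (λ k → ∃[ q ] (U on q ⇓ x × length q ≡ k)) (length p) (p , p⇓x , refl)
  ... | k , shortest , minimal = begin
    2 ^ length x                     ≤⟨ x∈R k (shortest , λ q q⇓x → minimal (length q) (q , q⇓x , refl)) ⟩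
    2 ^ k * length x ^ d             ≤⟨ *-monoˡ-≤ (length x ^ d) (^-monoʳ-≤ 2 (minimal (length p) (p , p⇓x , refl))) ⟩
    2 ^ length p * length x ^ d      ∎
    where open ≤-Reasoning

  R-dense : ∀ U d m → 1 ≤ m → AtLeast[1- 2 / m ^ d ]2^ (InR U d)
  R-dense U d m 1≤m = random , Unique.filter⁺ R? (strings-unique m) , All.tabulate good , (begin
    2 ^ m * q                                       ≡⟨ cong (_* q) (sym (length-strings m)) ⟩
    length (strings m) * q                          ≤⟨ *-monoˡ-≤ q (length-filter-+ R? compressible? ¬R⇒compressible (strings m)) ⟩
    (length random + length compressed) * q         ≡⟨ *-distribʳ-+ q (length random) (length compressed) ⟩
    length random * q + length compressed * q       ≤⟨ +-monoʳ-≤ (length random * q) few-compressed ⟩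
    length random * q + 2 * 2 ^ m                   ∎)
    where
    open ≤-Reasoning
    q = m ^ d
    Compressible : Str → Set
    Compressible x = ∃[ p ] (U on p ⇓ x × 2 ^ length p * length x ^ d < 2 ^ length x)
    R? : Decidable (InR U d)
    R? x = em
    compressible? : Decidable Compressible
    compressible? x = em
    ¬R⇒compressible : ∀ {x} → ¬ InR U d x → Compressible x
    ¬R⇒compressible {x} x∉R with em {Compressible x}
    ... | yes c = c
    -- If no program compresses x, then neither does a shortest one, which is membership in R.
    ... | no ¬c = absurd (λ { _ ((p , p⇓x , refl) , _) → ≮⇒≥ λ lt → ¬c (p , p⇓x , lt) }) x∉R
    random compressed : List Str
    random     = filter R? (strings m)
    compressed = filter compressible? (strings m)
    good : ∀ {x} → x ∈ random → length x ≡ m × InR U d x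
    good i with ∈-filter⁻ R? i
    ... | j , x∈R = All.lookup (strings-length m) j , x∈R
    instance
      m≢0 : NonZero m
      m≢0 = >-nonZero 1≤m
    threshold = few-short-strings q m (m^n>0 m d)
    k = proj₁ threshold
    program : ∀ {x} → x ∈ compressed → ∃[ p ] (p ∈ shorter k × U on p ⇓ x)
    program i with ∈-filter⁻ compressible? {xs = strings m} i
    ... | j , p , p⇓x , lt with All.lookup (strings-length m) j
    ...   | refl = p , ∈-shorter p (proj₁ (proj₂ threshold) (length p) lt) , p⇓x
    few-compressed : length compressed * q ≤ 2 * 2 ^ m
    few-compressed = begin
      length compressed * q      ≤⟨ *-monoˡ-≤ q (length-≤-via {R = U on_⇓_} (⇓-functional U) (shorter k)
                                      (Unique.filter⁺ compressible? (strings-unique m)) program) ⟩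
      length (shorter k) * q     ≤⟨ proj₂ (proj₂ threshold) ⟩
      2 * 2 ^ m                  ∎

-- Substitution

module _ {L : Language} where
  mutual
    -- The hypothesis is pointwise so that it can be restored under quantifiers without function
    -- extensionality.
    substT-var : ∀ {n} {σ : Fin n → Term L n} → (∀ i → σ i ≡ var i) → ∀ t → substT σ t ≡ t
    substT-var σ≗var (var i)    = σ≗var i
    substT-var σ≗var (app f ts) = cong (app f) (substTs-var σ≗var ts)

    substTs-var : ∀ {n k} {σ : Fin n → Term L n} → (∀ i → σ i ≡ var i) →
                  ∀ (ts : Vec _ k) → substTs σ ts ≡ ts
    substTs-var σ≗var []       = refl
    substTs-var σ≗var (t ∷ ts) = cong₂ _∷_ (substT-var σ≗var t) (substTs-var σ≗var ts)

  mutual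
    substT-∘ : ∀ {l m n} {ρ : Fin l → Term L m} {σ : Fin m → Term L n} {τ : Fin l → Term L n} →
               (∀ i → substT σ (ρ i) ≡ τ i) → ∀ t → substT σ (substT ρ t) ≡ substT τ t
    substT-∘ σρ≗τ (var i)    = σρ≗τ i
    substT-∘ σρ≗τ (app f ts) = cong (app f) (substTs-∘ σρ≗τ ts)

    substTs-∘ : ∀ {l m n k} {ρ : Fin l → Term L m} {σ : Fin m → Term L n} {τ : Fin l → Term L n} →
                (∀ i → substT σ (ρ i) ≡ τ i) → ∀ (ts : Vec _ k) → substTs σ (substTs ρ ts) ≡ substTs τ ts
    substTs-∘ σρ≗τ []       = refl
    substTs-∘ σρ≗τ (t ∷ ts) = cong₂ _∷_ (substT-∘ σρ≗τ t) (substTs-∘ σρ≗τ ts)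

  lift↑-var : ∀ {n} {σ : Fin n → Term L n} → (∀ i → σ i ≡ var i) → ∀ i → lift↑ σ i ≡ var i
  lift↑-var σ≗var zero    = refl
  lift↑-var σ≗var (suc i) = cong weakenT (σ≗var i)

  -- Weakening followed by `lift↑ σ`, and σ followed by weakening, are both the substitution
  -- `weakenT ∘ σ`.
  lift↑-∘ : ∀ {l m n} {ρ : Fin l → Term L m} {σ : Fin m → Term L n} {τ : Fin l → Term L n} →
            (∀ i → substT σ (ρ i) ≡ τ i) → ∀ i → substT (lift↑ σ) (lift↑ ρ i) ≡ lift↑ τ i
  lift↑-∘ σρ≗τ zero = refl
  lift↑-∘ {ρ = ρ} {σ} {τ} σρ≗τ (suc i) = begin
    substT (lift↑ σ) (weakenT (ρ i))   ≡⟨ substT-∘ {τ = weakenT ∘ σ} (λ _ → refl) (ρ i) ⟩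
    substT (weakenT ∘ σ) (ρ i)         ≡⟨ sym (substT-∘ (λ _ → refl) (ρ i)) ⟩
    weakenT (substT σ (ρ i))           ≡⟨ cong weakenT (σρ≗τ i) ⟩
    weakenT (τ i)                      ∎
    where open ≡-Reasoning

  subst-var : ∀ {n} {σ : Fin n → Term L n} → (∀ i → σ i ≡ var i) → ∀ φ → subst σ φ ≡ φ
  subst-var σ≗var (s ≐ t)    = cong₂ _≐_ (substT-var σ≗var s) (substT-var σ≗var t)
  subst-var σ≗var (rel r ts) = cong (rel r) (substTs-var σ≗var ts)
  subst-var σ≗var (¬̇ φ)      = cong ¬̇_ (subst-var σ≗var φ)
  subst-var σ≗var (φ ∧̇ ψ)    = cong₂ _∧̇_ (subst-var σ≗var φ) (subst-var σ≗var ψ)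
  subst-var σ≗var (φ ∨̇ ψ)    = cong₂ _∨̇_ (subst-var σ≗var φ) (subst-var σ≗var ψ)
  subst-var σ≗var (φ ⇒̇ ψ)    = cong₂ _⇒̇_ (subst-var σ≗var φ) (subst-var σ≗var ψ)
  subst-var σ≗var (∀̇ φ)      = cong ∀̇_ (subst-var (lift↑-var σ≗var) φ)
  subst-var σ≗var (∃̇ φ)      = cong ∃̇_ (subst-var (lift↑-var σ≗var) φ)

  subst-∘ : ∀ {l m n} {ρ : Fin l → Term L m} {σ : Fin m → Term L n} {τ : Fin l → Term L n} →
            (∀ i → substT σ (ρ i) ≡ τ i) → ∀ φ → subst σ (subst ρ φ) ≡ subst τ φ
  subst-∘ σρ≗τ (s ≐ t)    = cong₂ _≐_ (substT-∘ σρ≗τ s) (substT-∘ σρ≗τ t)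
  subst-∘ σρ≗τ (rel r ts) = cong (rel r) (substTs-∘ σρ≗τ ts)
  subst-∘ σρ≗τ (¬̇ φ)      = cong ¬̇_ (subst-∘ σρ≗τ φ)
  subst-∘ σρ≗τ (φ ∧̇ ψ)    = cong₂ _∧̇_ (subst-∘ σρ≗τ φ) (subst-∘ σρ≗τ ψ)
  subst-∘ σρ≗τ (φ ∨̇ ψ)    = cong₂ _∨̇_ (subst-∘ σρ≗τ φ) (subst-∘ σρ≗τ ψ)
  subst-∘ σρ≗τ (φ ⇒̇ ψ)    = cong₂ _⇒̇_ (subst-∘ σρ≗τ φ) (subst-∘ σρ≗τ ψ)
  subst-∘ σρ≗τ (∀̇ φ)      = cong ∀̇_ (subst-∘ (lift↑-∘ σρ≗τ) φ)
  subst-∘ σρ≗τ (∃̇ φ)      = cong ∃̇_ (subst-∘ (lift↑-∘ σρ≗τ) φ)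

  -- The form in which the rule `axiom` cites a sentence on a line with n free variables.
  inContext : ∀ n → Sentence L → Formula L n
  inContext n = rename λ ()

  inContext-0 : ∀ θ → inContext 0 θ ≡ θ
  inContext-0 = subst-var λ ()

  rename-inContext : ∀ {m n} (ρ : Fin m → Fin n) θ → rename ρ (inContext m θ) ≡ inContext n θ
  rename-inContext ρ = subst-∘ λ ()

-- Hilbert-style provability

module Provability {L : Language} (T : Theory L) where

  infix 2 ⊩_

  -- Open formulas and any position in the derivation are allowed, so derivations can be
  -- concatenated and the quantifier rules applied.
  ⊩_ : ∀ {n} → Formula L n → Set
  ⊩_ {n} φ = ∃[ Γ ] (Derivation T Γ × (n , φ) ∈ Γ)

  Justified-mono : ∀ {Γ Δ ℓ} → (∀ {k} → k ∈ Γ → k ∈ Δ) → Justified T Γ ℓ → Justified T Δ ℓ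
  Justified-mono Γ⊆Δ (axiom Tφ)      = axiom Tφ
  Justified-mono Γ⊆Δ (logical l)     = logical l
  Justified-mono Γ⊆Δ (mp i j)        = mp (Γ⊆Δ i) (Γ⊆Δ j)
  Justified-mono Γ⊆Δ (allI i)        = allI (Γ⊆Δ i)
  Justified-mono Γ⊆Δ (exE i)         = exE (Γ⊆Δ i)
  Justified-mono Γ⊆Δ (renameVar ρ i) = renameVar ρ (Γ⊆Δ i)

  Derivation-++ : ∀ {Γ Δ} → Derivation T Γ → Derivation T Δ → Derivation T (Γ ++ Δ)
  Derivation-++ []      e = e
  Derivation-++ (d ▷ j) e = Derivation-++ d e ▷ Justified-mono ∈-++⁺ˡ j

  infer₀ : ∀ {n} {φ : Formula L n} → Justified T [] (n , φ) → ⊩ φ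
  infer₀ j = _ , [] ▷ j , here refl

  infer₁ : ∀ {m n} {φ : Formula L m} {ψ : Formula L n} →
           (∀ {Γ} → (m , φ) ∈ Γ → Justified T Γ (n , ψ)) → ⊩ φ → ⊩ ψ
  infer₁ rule (Γ , d , i) = _ , d ▷ rule i , here refl

  ⊩-mp : ∀ {n} {φ ψ : Formula L n} → ⊩ φ ⇒̇ ψ → ⊩ φ → ⊩ ψ
  ⊩-mp (Γ , d , i) (Δ , e , j) = _ , Derivation-++ d e ▷ mp (∈-++⁺ˡ i) (∈-++⁺ʳ Γ j) , here refl

  -- Lines cite only earlier ones, so everything after the wanted line can be cut off.
  ⊩⇒⊢ : ∀ {φ : Sentence L} → ⊩ φ → T ⊢ φ

  module _ {n : ℕ} where
    private variable A B C : Formula L n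

    ⊩-logical : LogicalAxiom A → ⊩ A
    ⊩-logical l = infer₀ (logical l)

    ⊩-const : ⊩ B → ⊩ A ⇒̇ B
    ⊩-const = ⊩-mp (⊩-logical (const _ _))

    ⊩-distr : ⊩ A ⇒̇ B → ⊩ A ⇒̇ B ⇒̇ C → ⊩ A ⇒̇ C
    ⊩-distr ab abc = ⊩-mp (⊩-mp (⊩-logical (distr _ _ _)) ab) abc

    ⊩-id : ⊩ A ⇒̇ A
    ⊩-id {A} = ⊩-distr (⊩-logical (const A A)) (⊩-logical (const A (A ⇒̇ A)))

    ⊩-trans : ⊩ A ⇒̇ B → ⊩ B ⇒̇ C → ⊩ A ⇒̇ C
    ⊩-trans ab bc = ⊩-distr ab (⊩-const bc)

    ⊩-swap : ⊩ A ⇒̇ B ⇒̇ C → ⊩ B ⇒̇ A ⇒̇ C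
    ⊩-swap abc = ⊩-distr (⊩-const abc) (⊩-trans (⊩-logical (const _ _)) (⊩-logical (distr _ _ _)))

    ⊩-uncurry : ⊩ A ⇒̇ B ⇒̇ C → ⊩ A ∧̇ B ⇒̇ C
    ⊩-uncurry abc = ⊩-distr (⊩-logical (snd _ _)) (⊩-trans (⊩-logical (fst _ _)) abc)

    ⊩-curry : ⊩ A ∧̇ B ⇒̇ C → ⊩ A ⇒̇ B ⇒̇ C
    ⊩-curry abc = ⊩-trans (⊩-logical (pairI _ _))
                          (⊩-mp (⊩-swap (⊩-logical (distr _ _ _))) (⊩-const abc))

  ⊩⇒⊢ p with ⊩-mp ⊩-id p
  ... | q = head-proof p
    where
    head-proof : ∀ {φ : Sentence L} → ⊩ φ → T ⊢ φ
    head-proof (Γ , d , here refl) = Γ , d , _ , refl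
    head-proof (ℓ ∷ Γ , d ▷ _ , there i) = head-proof (Γ , d , i)

-- Every rule is replayed under the antecedent θ. Since θ is closed, renaming variables only moves
-- it to another context, so the quantifier rules and `renameVar` still apply.
deduction : ∀ {L} {T : Theory L} {θ : Sentence L} {Γ n φ} →
            Derivation (T ⊕ᵀ θ) Γ → (n , φ) ∈ Γ → Provability.⊩_ T (inContext n θ ⇒̇ φ)
deduction {L} {T} {θ} = ded
  where
  open Provability T
  ded : ∀ {Γ n φ} → Derivation (T ⊕ᵀ θ) Γ → (n , φ) ∈ Γ → ⊩ inContext n θ ⇒̇ φ
  just-ded : ∀ {Γ n φ} → Derivation (T ⊕ᵀ θ) Γ → Justified (T ⊕ᵀ θ) Γ (n , φ) → ⊩ inContext n θ ⇒̇ φ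
  ded (d ▷ j) (here refl) = just-ded d j
  ded (d ▷ j) (there i)   = ded d i
  just-ded d (axiom (inj₁ Tφ))   = ⊩-const (infer₀ (axiom Tφ))
  just-ded d (axiom (inj₂ refl)) = ⊩-id
  just-ded d (logical l)         = ⊩-const (⊩-logical l)
  just-ded d (mp i j)            = ⊩-distr (ded d j) (ded d i)
  -- θ joins C in a conjunction, giving the single weakened antecedent that `allI` expects.
  just-ded {n = n} d (allI {C = C} {A} i) =
    ⊩-curry (infer₁ {φ = weaken (inContext n θ ∧̇ C) ⇒̇ A} allI
      (⊩-uncurry (transport (λ χ → ⊩ χ ⇒̇ weaken C ⇒̇ A) (sym (rename-inContext suc θ)) (ded d i))))
  -- θ moves into the consequent, which `exE` expects to be weakened.
  just-ded {n = n} d (exE {A = A} {C} i) =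
    ⊩-swap (infer₁ {φ = A ⇒̇ weaken (inContext n θ ⇒̇ C)} exE
      (⊩-swap (transport (λ χ → ⊩ χ ⇒̇ A ⇒̇ weaken C) (sym (rename-inContext suc θ)) (ded d i))))
  just-ded d (renameVar {m} {n} {φ} ρ i) =
    transport (λ χ → ⊩ χ ⇒̇ rename ρ φ) (rename-inContext ρ θ)
      (infer₁ {φ = inContext m θ ⇒̇ φ} (renameVar ρ) (ded d i))

deduction-⊢ : ∀ {L} {T : Theory L} {θ φ : Sentence L} {Γ} → IsProof (T ⊕ᵀ θ) φ Γ → T ⊢ θ ⇒̇ φ
deduction-⊢ {T = T} {θ} {φ} (d , _ , refl) =
  transport (λ χ → T ⊢ χ ⇒̇ φ) (inContext-0 θ) (Provability.⊩⇒⊢ T (deduction d (here refl)))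

-- Satisfaction

mutual
  evalT-subst : ∀ {m n} {σ : Fin m → Term Lᵇ n} {e e′} →
                (∀ i → evalT e (σ i) ≡ Vec.lookup e′ i) → ∀ t → evalT e (substT σ t) ≡ evalT e′ t
  evalT-subst eσ≗e′ (var i)    = eσ≗e′ i
  evalT-subst eσ≗e′ (app f ts) = cong (evalFn f) (evalTs-subst eσ≗e′ ts)

  evalTs-subst : ∀ {m n k} {σ : Fin m → Term Lᵇ n} {e e′} →
                 (∀ i → evalT e (σ i) ≡ Vec.lookup e′ i) →
                 ∀ (ts : Vec _ k) → evalTs e (substTs σ ts) ≡ evalTs e′ ts
  evalTs-subst eσ≗e′ []       = refl
  evalTs-subst eσ≗e′ (t ∷ ts) = cong₂ _∷_ (evalT-subst eσ≗e′ t) (evalTs-subst eσ≗e′ ts)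

evalT-lift↑ : ∀ {m n} {σ : Fin m → Term Lᵇ n} {e e′} x → (∀ i → evalT e (σ i) ≡ Vec.lookup e′ i) →
              ∀ i → evalT (x ∷ e) (lift↑ σ i) ≡ Vec.lookup (x ∷ e′) i
evalT-lift↑ x eσ≗e′ zero = refl
evalT-lift↑ {σ = σ} x eσ≗e′ (suc i) = trans (evalT-subst (λ _ → refl) (σ i)) (eσ≗e′ i)

≡⇒⇔ : ∀ {A B : Set} → A ≡ B → A ⇔ B
≡⇒⇔ refl = mk⇔ (λ a → a) (λ a → a)

-- An equivalence rather than an implication, because negation and implication reverse the direction
-- in the induction.
⊨-subst : ∀ {m n} {σ : Fin m → Term Lᵇ n} {e e′} → (∀ i → evalT e (σ i) ≡ Vec.lookup e′ i) →
          ∀ φ → (e ⊨ subst σ φ) ⇔ (e′ ⊨ φ)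
⊨-subst eσ≗e′ (s ≐ t)    = ≡⇒⇔ (cong₂ _≡_ (evalT-subst eσ≗e′ s) (evalT-subst eσ≗e′ t))
⊨-subst eσ≗e′ (rel r ts) = ≡⇒⇔ (cong (evalRel r) (evalTs-subst eσ≗e′ ts))
⊨-subst eσ≗e′ (¬̇ φ)      = let f = ⊨-subst eσ≗e′ φ in mk⇔ (_∘ from f) (_∘ to f)
⊨-subst eσ≗e′ (φ ∧̇ ψ)    = ⊨-subst eσ≗e′ φ ×-⇔ ⊨-subst eσ≗e′ ψ
⊨-subst eσ≗e′ (φ ∨̇ ψ)    = ⊨-subst eσ≗e′ φ ⊎-⇔ ⊨-subst eσ≗e′ ψ
⊨-subst eσ≗e′ (φ ⇒̇ ψ)    = let f = ⊨-subst eσ≗e′ φ; g = ⊨-subst eσ≗e′ ψ in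
  mk⇔ (λ h → to g ∘ h ∘ from f) (λ h → from g ∘ h ∘ to f)
⊨-subst eσ≗e′ (∀̇ φ)      = let f = λ x → ⊨-subst (evalT-lift↑ x eσ≗e′) φ in
  mk⇔ (λ h x → to (f x) (h x)) (λ h x → from (f x) (h x))
⊨-subst eσ≗e′ (∃̇ φ)      = let f = λ x → ⊨-subst (evalT-lift↑ x eσ≗e′) φ in
  mk⇔ (λ (x , h) → x , to (f x) h) (λ (x , h) → x , from (f x) h)

evalT-numeralᵇ : ∀ {n} (e : Vec ℕ n) b → evalT e (numeralᵇ b) ≡ ℕᵇ.toℕ b
evalT-numeralᵇ e ℕᵇ.zero  = refl
evalT-numeralᵇ e 2[1+ b ] = cong (λ k → 2 * suc k) (evalT-numeralᵇ e b)
evalT-numeralᵇ e 1+[2 b ] = cong (λ k → suc (2 * k)) (evalT-numeralᵇ e b)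

evalT-num : ∀ {n} (e : Vec ℕ n) k → evalT e (num k) ≡ k
evalT-num e k = trans (evalT-numeralᵇ e (fromℕ k)) (ℕᵇ.toℕ-fromℕ k)

evalT-^̇ : ∀ {n} (e : Vec ℕ n) t d → evalT e (t ^̇ d) ≡ evalT e t ^ d
evalT-^̇ e t zero    = refl
evalT-^̇ e t (suc d) = cong (evalT e t *_) (evalT-^̇ e t d)

-- Codes of strings

private
  push : ℕ → Bool → ℕ
  push c b = 2 * c + bitℕ b

⌊push/2⌋ : ∀ c b → ⌊ push c b /2⌋ ≡ c
⌊push/2⌋ zero    false = refl
⌊push/2⌋ zero    true  = refl
⌊push/2⌋ (suc c) b = trans (cong (λ k → ⌊ suc k + bitℕ b /2⌋) (+-suc c (c + 0))) (cong suc (⌊push/2⌋ c b))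

push-injective : ∀ {c c′ b b′} → push c b ≡ push c′ b′ → c ≡ c′ × b ≡ b′
push-injective {c} {c′} {b} {b′} h
  with trans (sym (⌊push/2⌋ c b)) (trans (cong ⌊_/2⌋ h) (⌊push/2⌋ c′ b′))
... | refl = refl , bitℕ-injective b b′ (+-cancelˡ-≡ (2 * c) _ _ h)
  where
  bitℕ-injective : ∀ b b′ → bitℕ b ≡ bitℕ b′ → b ≡ b′
  bitℕ-injective false false _ = refl
  bitℕ-injective true  true  _ = refl

-- Since ⌈ suc n /2⌉ is suc ⌊ n /2⌋ by computation.
bitLength-half : ∀ n → bitLength ⌊ n /2⌋ ≡ bitLength n ∸ 1
bitLength-half n = ⌈log₂⌈n/2⌉⌉≡⌈log₂n⌉∸1 (suc n)

-- Halving removes the pushed bit and lowers the bit length by a truncated 1; as c is positive,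
-- nothing is truncated.
bitLength-push : ∀ c b → 1 ≤ c → bitLength (push c b) ≡ suc (bitLength c)
bitLength-push c@(suc _) b 1≤c = begin
  bitLength (push c b)                   ≡⟨ sym (m+[n∸m]≡n positive) ⟩
  suc (bitLength (push c b) ∸ 1)         ≡⟨ cong suc (sym (bitLength-half (push c b))) ⟩
  suc (bitLength ⌊ push c b /2⌋)         ≡⟨ cong (suc ∘ bitLength) (⌊push/2⌋ c b) ⟩
  suc (bitLength c)                      ∎
  where
  open ≡-Reasoning
  positive : 1 ≤ bitLength (push c b)
  positive = ⌈log₂⌉-mono-≤ {2} {suc (push c b)} (s≤s (s≤s z≤n))

bitLength-code : ∀ w → bitLength (code w) ≡ suc (length w)
bitLength-code w = trans (go 1 w (s≤s z≤n)) (+-comm (length w) 1)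
  where
  go : ∀ c w → 1 ≤ c → bitLength (foldl push c w) ≡ length w + bitLength c
  go c []      1≤c = refl
  go c (b ∷ w) 1≤c = begin
    bitLength (foldl push (push c b) w)   ≡⟨ go (push c b) w (≤-trans 1≤c (≤-trans (m≤m+n c (c + 0)) (m≤m+n (2 * c) (bitℕ b)))) ⟩
    length w + bitLength (push c b)       ≡⟨ cong (length w +_) (bitLength-push c b 1≤c) ⟩
    length w + suc (bitLength c)          ≡⟨ +-suc (length w) (bitLength c) ⟩
    suc (length w + bitLength c)          ∎
    where open ≡-Reasoning

-- The leading 1 lets the bit length of a code reveal the length of the string; for equal lengths
-- the pushes are undone one by one.
code-injective : ∀ {v w} → code v ≡ code w → v ≡ w
code-injective {v} {w} h =
  proj₂ (go v w (suc-injective (trans (sym (bitLength-code v)) (trans (cong bitLength h) (bitLength-code w)))) h)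
  where
  go : ∀ v w {c c′} → length v ≡ length w → foldl push c v ≡ foldl push c′ w → c ≡ c′ × v ≡ w
  go []      []      _  h = h , refl
  go (a ∷ v) (b ∷ w) {c} {c′} ls h with go v w (suc-injective ls) h
  ... | h′ , refl with push-injective {c} {c′} {a} {b} h′
  ...   | refl , refl = refl , refl

-- Unique readability

readSymbols : Str → List Symbol
readSymbols (false ∷ false ∷ false ∷ false ∷ w) = d1 ∷ readSymbols w
readSymbols (false ∷ false ∷ false ∷ true  ∷ w) = d2 ∷ readSymbols w
readSymbols (false ∷ false ∷ true  ∷ false ∷ w) = var ∷ readSymbols w
readSymbols (false ∷ false ∷ true  ∷ true  ∷ w) = fn ∷ readSymbols w
readSymbols (false ∷ true  ∷ false ∷ false ∷ w) = rel ∷ readSymbols w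
readSymbols (false ∷ true  ∷ false ∷ true  ∷ w) = eq ∷ readSymbols w
readSymbols (false ∷ true  ∷ true  ∷ false ∷ w) = neg ∷ readSymbols w
readSymbols (false ∷ true  ∷ true  ∷ true  ∷ w) = and ∷ readSymbols w
readSymbols (true  ∷ false ∷ false ∷ false ∷ w) = or ∷ readSymbols w
readSymbols (true  ∷ false ∷ false ∷ true  ∷ w) = imp ∷ readSymbols w
readSymbols (true  ∷ false ∷ true  ∷ false ∷ w) = all ∷ readSymbols w
readSymbols (true  ∷ false ∷ true  ∷ true  ∷ w) = ex ∷ readSymbols w
readSymbols (true  ∷ true  ∷ false ∷ false ∷ w) = newline ∷ readSymbols w
-- The default serves the end of the text; blocks that encode no symbol do not occur in the image of
-- `bits`.
readSymbols _ = []

readSymbols-bits : ∀ s → readSymbols (bits s) ≡ s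
readSymbols-bits []            = refl
readSymbols-bits (d1 ∷ s)      = cong (d1 ∷_) (readSymbols-bits s)
readSymbols-bits (d2 ∷ s)      = cong (d2 ∷_) (readSymbols-bits s)
readSymbols-bits (var ∷ s)     = cong (var ∷_) (readSymbols-bits s)
readSymbols-bits (fn ∷ s)      = cong (fn ∷_) (readSymbols-bits s)
readSymbols-bits (rel ∷ s)     = cong (rel ∷_) (readSymbols-bits s)
readSymbols-bits (eq ∷ s)      = cong (eq ∷_) (readSymbols-bits s)
readSymbols-bits (neg ∷ s)     = cong (neg ∷_) (readSymbols-bits s)
readSymbols-bits (and ∷ s)     = cong (and ∷_) (readSymbols-bits s)
readSymbols-bits (or ∷ s)      = cong (or ∷_) (readSymbols-bits s)
readSymbols-bits (imp ∷ s)     = cong (imp ∷_) (readSymbols-bits s)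
readSymbols-bits (all ∷ s)     = cong (all ∷_) (readSymbols-bits s)
readSymbols-bits (ex ∷ s)      = cong (ex ∷_) (readSymbols-bits s)
readSymbols-bits (newline ∷ s) = cong (newline ∷_) (readSymbols-bits s)

gödel-injective : ∀ {s t} → gödel s ≡ gödel t → s ≡ t
gödel-injective {s} {t} h =
  trans (sym (readSymbols-bits s)) (trans (cong readSymbols (code-injective h)) (readSymbols-bits t))

-- Equality of pairs, since the arity is determined only together with the symbol.
fnIndex≡0 : ∀ {L k} (f : Fn L k) → fnIndex f ≡ 0 → _≡_ {A = Σ ℕ (Fn L)} (k , f) (0 , zeroᶠ)
fnIndex≡0 zeroᶠ _ = refl

fnIndex≡1 : ∀ {L k} (f : Fn L k) → fnIndex f ≡ 1 → _≡_ {A = Σ ℕ (Fn L)} (k , f) (1 , sucᶠ)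
fnIndex≡1 sucᶠ _ = refl

no-digits : ∀ k {s} → digits k ++ s ≡ [] → k ≡ 0
no-digits k h with fromℕ k in k≡
no-digits k h | ℕᵇ.zero = ℕᵇ.fromℕ-injective k≡

writeT-zero : ∀ {L} (t : Term L 0) → writeT t ≡ fn ∷ [] → t ≡ Z
writeT-zero (app f ts) h with fnIndex≡0 f (no-digits (fnIndex f) (∷-injectiveʳ h))
writeT-zero (app _ []) h | refl = refl

-- A symbol fn is not a digit, hence the function index before it is that of zero.
writeT-zero-++ : ∀ {L} (t : Term L 0) {r s} → writeT t ++ r ≡ fn ∷ fn ∷ s → t ≡ Z × r ≡ fn ∷ s
writeT-zero-++ (app f ts) h with fromℕ (fnIndex f) in k≡
writeT-zero-++ (app f ts) h | ℕᵇ.zero with fnIndex≡0 f (ℕᵇ.fromℕ-injective k≡)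
writeT-zero-++ (app _ []) h | ℕᵇ.zero | refl = refl , ∷-injectiveʳ h

writeT-one : ∀ {L} (t : Term L 0) → writeT t ≡ fn ∷ d1 ∷ fn ∷ [] → t ≡ 𝟏
writeT-one (app f ts) h with fromℕ (fnIndex f) in k≡
writeT-one (app f ts) h | ℕᵇ.zero with fnIndex≡0 f (ℕᵇ.fromℕ-injective k≡)
writeT-one (app _ []) () | ℕᵇ.zero | refl
-- A `d1` followed by the non-digit `fn` leaves 1 as the only index, that of the successor.
writeT-one (app f ts) h | 1+[2 ℕᵇ.zero ] with fnIndex≡1 f (ℕᵇ.fromℕ-injective k≡)
writeT-one (app _ (t ∷ [])) h | 1+[2 ℕᵇ.zero ] | refl =
  cong 𝐒 (writeT-zero t (trans (sym (++-identityʳ (writeT t))) (∷-injectiveʳ (∷-injectiveʳ h))))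

-- `Proves` gives the proved formula only through its Gödel number, so it is recovered by parsing
-- the one text `eq fn fn d1 fn`.
write-contradiction : ∀ {L} (φ : Sentence L) → write φ ≡ write (contradiction {L}) → φ ≡ contradiction
write-contradiction (s ≐ t) h with writeT-zero-++ s (∷-injectiveʳ h)
... | refl , h′ = cong (Z ≐_) (writeT-one t h′)

-- Truth of the consistency statements

-- The arithmetized inequality is that of `InR-bound` with both sides doubled: the leading 1 of a
-- code makes 1#x equal to 2·2^|x|, and halving the code corrects its bit length to |x|.
inR-true : ∀ {U d} (em : ExcludedMiddle 0ℓ) (𝒰 : UArithmetization U) {x} → InR U d x → ℕ⊨ inR 𝒰 d x
inR-true {U} {d} em 𝒰 {x} x∈R p outputs-p-x
  with to (outputs-correct p (code x)) (to (⊨-subst env outputs) outputs-p-x)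
  where
  open UArithmetization 𝒰
  env : ∀ i → evalT (p ∷ []) (Vec.lookup (var zero ∷ num (code x) ∷ []) i) ≡ Vec.lookup (p ∷ code x ∷ []) i
  env zero       = refl
  env (suc zero) = evalT-num (p ∷ []) (code x)
... | w , y , refl , x≡y , w⇓y with code-injective {x} {y} x≡y
...   | refl = goal
  where
  open ≤-Reasoning
  e : Vec ℕ 1
  e = code w ∷ []
  1♯ : ∀ v → 2 ^ (bitLength 1 * bitLength (code v)) ≡ 2 * 2 ^ length v
  1♯ v = cong (2 ^_) (trans (*-identityˡ _) (bitLength-code v))
  x̄ : Term Lᵇ 1
  x̄ = num (code x)
  length-x : evalT e ∣ ½ x̄ ∣ ≡ length x
  length-x = trans (cong (λ k → bitLength ⌊ k /2⌋) (evalT-num e (code x)))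
                   (trans (bitLength-half (code x)) (cong (_∸ 1) (bitLength-code x)))
  goal : evalT e (𝟏 ♯ x̄) ≤ evalT e ((𝟏 ♯ var zero) ∙ (∣ ½ x̄ ∣ ^̇ d))
  goal = begin
    2 ^ (bitLength 1 * bitLength (evalT e x̄))                     ≡⟨ cong (λ k → 2 ^ (bitLength 1 * bitLength k)) (evalT-num e (code x)) ⟩
    2 ^ (bitLength 1 * bitLength (code x))                        ≡⟨ 1♯ x ⟩
    2 * 2 ^ length x                                              ≤⟨ *-monoʳ-≤ 2 (InR-bound em {d = d} x∈R w⇓y) ⟩
    2 * (2 ^ length w * length x ^ d)                             ≡⟨ sym (*-assoc 2 (2 ^ length w) (length x ^ d)) ⟩
    2 * 2 ^ length w * length x ^ d                               ≡⟨ cong₂ _*_ (sym (1♯ w)) (sym (trans (evalT-^̇ e ∣ ½ x̄ ∣ d) (cong (_^ d) length-x))) ⟩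
    evalT e ((𝟏 ♯ var zero) ∙ (∣ ½ x̄ ∣ ^̇ d))                      ∎

-- `lift` commutes with implication, so the deduction theorem yields a lifted arithmetical sentence,
-- to which soundness applies; its truth together with that of θ gives 0 = 1.
Sound⇒consistent : ∀ {L} {S : Theory L} → Sound S → ∀ {θ : Sentence Lᵇ} → ℕ⊨ θ →
                   ∀ {Γ} → ¬ IsProof (S ⊕ᵀ lift θ) contradiction Γ
Sound⇒consistent sound {θ} ⊨θ proof with sound (θ ⇒̇ contradiction) (deduction-⊢ proof) ⊨θ
... | ()

⌜⌝-contradiction : ∀ {L} (φ : Sentence L) → ⌜ contradiction {L} ⌝ ≡ ⌜ φ ⌝ → φ ≡ contradiction
⌜⌝-contradiction {L} φ h =
  write-contradiction φ (sym (gödel-injective {write (contradiction {L})} {write φ} h))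

-- Stated for arbitrary numbers c and k, so that no Gödel number gets evaluated during type checking.
bounded-consistency-true : ∀ {prf⁺ : Formula Lᵇ 3} {c k} → (∀ p → ¬ (p ∷ c ∷ k ∷ [] ⊨ prf⁺)) →
  ∀ n → ℕ⊨ (∀̇ (lengthAtMost (var zero) n ⇒̇ ¬̇ prf⁺ ⟨ var zero ∷ num c ∷ num k ∷ [] ⟩))
bounded-consistency-true {prf⁺} {c} {k} irrefutable n p _ refuted =
  irrefutable p (to (⊨-subst env prf⁺) refuted)
  where
  env : ∀ i → evalT (p ∷ []) (Vec.lookup (var zero ∷ num c ∷ num k ∷ []) i) ≡ Vec.lookup (p ∷ c ∷ k ∷ []) i
  env zero             = refl
  env (suc zero)       = evalT-num (p ∷ []) c
  env (suc (suc zero)) = evalT-num (p ∷ []) k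

module _ {L} {S : Theory L} (P : ProofPredicates S) (sound : Sound S) {θ : Sentence Lᵇ} (⊨θ : ℕ⊨ θ) where
  open ProofPredicates P

  unprovable : ∀ p → ¬ Proves (S ⊕ᵀ lift θ) p ⌜ contradiction {L} ⌝
  unprovable p (Γ , φ , proof , _ , h) =
    Sound⇒consistent sound ⊨θ (transport (λ χ → IsProof (S ⊕ᵀ lift θ) χ Γ) (⌜⌝-contradiction φ h) proof)

  irrefutable : ∀ p → ¬ (p ∷ ⌜ contradiction {L} ⌝ ∷ ⌜ lift {L} θ ⌝ ∷ [] ⊨ prf⁺)
  irrefutable p h = unprovable p (to (prf⁺-correct p ⌜ contradiction {L} ⌝ (lift θ)) h)

Con⁺≤-true : ∀ {L} {S : Theory L} (P : ProofPredicates S) → Sound S → ∀ {θ : Sentence Lᵇ} → ℕ⊨ θ →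
             ∀ n → ℕ⊨ Con⁺≤ P (lift θ) n
Con⁺≤-true {L} {S} P sound {θ} ⊨θ n =
  bounded-consistency-true {ProofPredicates.prf⁺ P} {⌜ contradiction {L} ⌝} {⌜ lift {L} θ ⌝}
    (irrefutable P sound {θ} ⊨θ) n

-- Transfer of the lower bound to propositional proofs

corollary3p5 : ExcludedMiddle 0ℓ →
    (U : TM) → Universal U → (d : ℕ) → 3 ≤ d → (𝒰 : UArithmetization U) →
    (L : Language) (S : Theory L) →
    Sound S → FinitelyAxiomatized S → Sequential S → ExtendsS¹₂ S → PolyTimeAxioms S →
    (P : ProofPredicates S) →
    PolySizeProofs S (λ n → lift (Con≤ P n)) →
    (k : ℕ) → ExceedsC-rel 𝒰 d P k → SETH-K-Finite 𝒰 d P k →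
    (𝒯 : TautologyPredicate) (𝒫 : PropTranslation (ConR≤ 𝒰 d P)) →
    (a : ℕ) → Correspondence 𝒯 S (ConR≤ 𝒰 d P) 𝒫 a →
    let open PropTranslation 𝒫 in
    ∃[ C ] ∃[ b ] ∀ (m : ℕ) → k < m → ∀ (ε : ℝ) → 0< ε → ε <1 →
    ∃[ N ] ∀ (n : ℕ) → N < n →
    AtLeast[1- C / m ^ d ]2^ (λ x →
    Tautology (τ x n)
    × propSize (τ x n) ≤ (m + n) ^ b
    × RequiresProofSize>2^[1- ε ]· n 𝒯 S (τ x n))
corollary3p5 em U _ d _ 𝒰 L S sound _ _ _ _ P _ k exceeds seth 𝒯 𝒫 a (_ , _ , carried) =
  -- Both constants precede m, ε and n: 2 comes from the count in `R-dense`, the exponent from the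
  -- size bound of the translation.
  2 , proj₁ polysize , λ m k<m ε 0<ε ε<1 →
    let a₀ , b₀ , q<ε = positive-lower ε 0<ε
        N₁ , sethN₁   = seth m k<m (halfReciprocal b₀) (0<halfReciprocal b₀) (halfReciprocal<1 b₀)
        -- With B = `suc b₀` the exponent is a·2B, so that the 2B-th power of the overhead (m+n)^a
        -- stays below 2^n.
        N₂ , small    = polynomial≤2^n m (a * suc (b₀ + suc b₀))
        1≤m           = ≤-trans (s≤s z≤n) k<m
    in N₁ ⊔ N₂ , λ n N<n →
      let xs , unique , all-random , many = R-dense em U d m 1≤m
          -- Both m and n are at least 1, which reaches the range where the translation and the
          -- correspondence are bounded.
          2≤m+n = +-mono-≤ 1≤m (≤-trans (s≤s z≤n) N<n)
          good : ∀ {x} → length x ≡ m × InR U d x → length x ≡ m × Tautology (τ x n)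
                 × propSize (τ x n) ≤ (m + n) ^ proj₁ polysize
                 × RequiresProofSize>2^[1- ε ]· n 𝒯 S (τ x n)
          good = λ { {x} (refl , x∈R) →
              refl
            , from (correct x n) (Con⁺≤-true P sound {inR 𝒰 d x} (inR-true {d = d} em 𝒰 x∈R) n)
            , proj₂ polysize x n 2≤m+n
            , λ Γ prop-proof →
                let Δ , proof , _ , Δ≤ = carried x n Γ 2≤m+n prop-proof
                    m+n^a-small = ≤-trans (≤-reflexive (^-*-assoc (m + n) a (suc (b₀ + suc b₀))))
                                          (small n (≤-<-trans (m≤n⊔m N₁ N₂) N<n))
                -- A short Δ would, by the hypothesis at 1/(2B), put x into `C-rel`, whose members
                -- are shorter than k, whereas x has length m > k.
                in size-transfer ε q<ε n {s = proofSize Γ} m+n^a-small Δ≤ λ Δ-short →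
                     <-asym k<m (exceeds x (x∈R ,
                       to (sethN₁ x x∈R refl n (≤-<-trans (m≤m⊔n N₁ N₂) N<n)) (Δ , proof , Δ-short))) }
      in xs , unique , All.map good all-random , many
  where
  open PropTranslation 𝒫
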